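{- Let $q_0$ be a rational number such that neither $2+q_0$ nor $2-q_0$ is a rational square. Then for every $k=1,2,\dots$: $(\Omega_k^+\setminus\Omega_k^-)\cap R_{k-1}\subset \Pi_0(q_0)\cap\{p: 2^{k-1}\,\|\,\widehat p\}$; $(\Omega_k^-\setminus\Omega_k^+)\cap R_{k-1}\subset \Pi_1(q_0)\cap\{p: 2^{k-1}\,\|\,\widehat p\}$; $Z_k\subset \Pi_*(q_0)\cap\{p: 2^{k}\mid\widehat p\}$; and $R_k\subset\{p:2^k\mid\widehat p\}$.
   Context: Chebyshev polynomials: $U_0=0$, $U_1=1$, $U_{n+1}=qU_n-U_{n-1}$; $C_n=U_{n+1}-U_{n-1}$ (so $C_0=2$, $C_1=q$, $C_2=q^2-2$); for odd $n=2k+1$, $V_n=U_{k+1}-U_k$, $W_n=U_{k+1}+U_k$. For a rational $q$, congruences mod an odd prime $p$ not dividing the denominator of $q$ are taken in $\mathbb F_p$, and: $p\in\Pi_0(q)$ if $W_n(q)\equiv0$ for some odd $n\ge1$; $p\in\Pi_1(q)$ if $V_n(q)\equiv0$ for some odd $n\ge1$; $p\in\Pi_{2+k}(q)$ ($k\ge0$) if $C_{2^kn}(q)\equiv0$ for some odd $n\ge1$; $\Pi_*(q)=\bigcup_{k\ge2}\Pi_k(q)$. Legendre symbol of a rational $x=a/b$ (lowest terms) at an odd prime $p\nmid b$: $(x|p)=1$ if $ab$ is a nonzero square mod $p$, $-1$ if a nonsquare, $0$ if $p\mid a$. Let $\delta=q_0^2-4$, and let $\Pi'$ be the set of odd primes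 dividing neither the numerator nor the denominator of $\delta$; for $p\in\Pi'$ put $\widehat p=\frac{p-(\delta|p)}{2}$. All sets below are subsets of $\Pi'$. For $s\ge1$, $\Omega_s^{\pm}=\{p\in\Pi': C_{2^s}(a)\equiv\pm q_0 \bmod p \text{ for some } a\in\mathbb F_p\}$, and $\Omega_0^\pm=\Pi'$. $R_k=\Omega_k^+\cap\Omega_k^-$ (so $R_0=\Pi'$), $Z_k=R_{k-1}\setminus(\Omega_k^+\cup\Omega_k^-)$. $2^j\,\|\,m$ means $2^j\mid m$ and $2^{j+1}\nmid m$. -}

module Defs where

open import Data.Bool using (Bool; true; false; if_then_else_; _∧_)
open import Data.Nat as ℕ using (ℕ; zero; suc; _≤_; _<_; _^_; _≡ᵇ_)
open import Data.Nat.Divisibility using (_∣_)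
open import Data.Nat.Primality using (Prime)
open import Data.Integer as ℤ using (ℤ; +_; _%ℕ_)
open import Data.Rational as ℚ using (ℚ; ↥_; ↧_; ↧ₙ_; 0ℚ; 1ℚ; _+_; _-_; _*_)
open import Data.List using (upTo)
open import Data.Bool.ListAction using (any)
open import Data.Product using (Σ; ∃; ∃-syntax; _×_)
open import Relation.Nullary using (¬_)
open import Relation.Binary.PropositionalEquality using (_≡_)

-- Chebyshev polynomials, evaluated at a rational q.

U : ℕ → ℚ → ℚ
U zero          q = 0ℚ
U (suc zero)    q = 1ℚ
U (suc (suc n)) q = q * U (suc n) q - U n q

-- C_n = U_{n+1} - U_{n-1}; for n = 0 this is U_1 - U_{-1} = 2.
C : ℕ → ℚ → ℚ
C zero    q = 1ℚ + 1ℚ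
C (suc n) q = U (suc (suc n)) q - U n q

-- For odd n = 2k+1:  V_n = U_{k+1} - U_k,  W_n = U_{k+1} + U_k
-- (only used at odd arguments; k = ⌊n/2⌋).
V : ℕ → ℚ → ℚ
V n q = U (suc (n ℕ./ 2)) q - U (n ℕ./ 2) q

W : ℕ → ℚ → ℚ
W n q = U (suc (n ℕ./ 2)) q + U (n ℕ./ 2) q

-- Congruences in 𝔽_p for rationals (p not dividing the denominator):
-- x ≡ 0 in 𝔽_p iff p divides the numerator of x in lowest terms.

_≡0mod_ : ℚ → ℕ → Set
x ≡0mod p = p ∣ ℤ.∣ ↥ x ∣

OddPrime : ℕ → Set
OddPrime p = Prime p × ¬ (2 ∣ p)

_∥_ : ℕ → ℕ → Set
d ∥ m = d ∣ m × ¬ (2 ℕ.* d ∣ m)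

-- Legendre symbol (x|p) of a rational x = a/b (lowest terms), p odd prime
-- not dividing b: 1 if ab is a nonzero square mod p, -1 if a nonsquare,
-- 0 if p ∣ a.  Squares are detected by checking all residues 1..p-1.

legendre : ℚ → ℕ → ℤ
legendre x zero    = ℤ.0ℤ
legendre x (suc n) =
  let r = (↥ x ℤ.* ↧ x) %ℕ suc n in
  if r ≡ᵇ 0 then ℤ.0ℤ
  else if any (λ y → ((suc y ℕ.* suc y) ℕ.% suc n) ≡ᵇ r) (upTo n)
       then ℤ.1ℤ else ℤ.-1ℤ

module _ (q₀ : ℚ) where

  δ : ℚ
  δ = q₀ * q₀ - (1ℚ + 1ℚ + 1ℚ + 1ℚ)

  Π′ : ℕ → Set
  Π′ p = OddPrime p × ¬ (p ∣ ℤ.∣ ↥ δ ∣) × ¬ (p ∣ ↧ₙ δ)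

  hat : ℕ → ℕ
  hat p = ℤ.∣ (+ p) ℤ.- legendre δ p ∣ ℕ./ 2

  Π : ℕ → ℕ → Set
  Π zero          p = OddPrime p × ¬ (p ∣ ↧ₙ q₀) × ∃[ k ] (W (2 ℕ.* k ℕ.+ 1) q₀ ≡0mod p)
  Π (suc zero)    p = OddPrime p × ¬ (p ∣ ↧ₙ q₀) × ∃[ k ] (V (2 ℕ.* k ℕ.+ 1) q₀ ≡0mod p)
  Π (suc (suc j)) p = OddPrime p × ¬ (p ∣ ↧ₙ q₀) × ∃[ k ] (C (2 ^ j ℕ.* (2 ℕ.* k ℕ.+ 1)) q₀ ≡0mod p)

  Π* : ℕ → Set
  Π* p = ∃[ k ] (2 ≤ k × Π k p)

  data Sign : Set where
    plus minus : Sign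

  _±_ : ℚ → Sign → ℚ
  x ± plus  = x - q₀
  x ± minus = x + q₀

  Ω : Sign → ℕ → ℕ → Set
  Ω σ zero    p = Π′ p
  Ω σ (suc s) p = Π′ p × ∃[ a ] (a < p × ((C (2 ^ suc s) ((+ a) ℚ./ 1) ± σ) ≡0mod p))

  R : ℕ → ℕ → Set
  R k p = Ω plus k p × Ω minus k p

  Z : ℕ → ℕ → Set
  Z k p = R (k ℕ.∸ 1) p × ¬ Ω plus k p × ¬ Ω minus k p

IsRationalSquare : ℚ → Set
IsRationalSquare x = ∃[ r ] (r * r ≡ x)

{-# OPTIONS --safe #-}

-- Write q₀ = z + 1/z mod p. Then z lies in a group G of order 2 p̂ — 𝔽_p^× or the norm-one subgroup of 𝔽_{p²}^× —
-- and p ∈ Ω_k^± means that ±z is a 2^k-th power in G. All that is used about G is that w^{2p̂} = 1 and that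
-- w is a square as soon as w^{p̂} = 1. In terms of traces a = w + 1/w, both follow from
-- C_{p̂}(a) = 2 (a + 2)^{(p-1)/2}, which comes from Frobenius in 𝔽_p[z]/(z² - a z + 1) applied to
-- (1 + z)² = z (a + 2), and from Euler's criterion for a + 2.

module Submission where

open import Defs
open import Algebra.Bundles using (CommutativeRing; CommutativeSemiring)
open import Data.Bool using (T; false; true)
open import Data.Bool.ListAction using (any)
open import Data.Empty using (⊥-elim)
open import Data.Fin as Fin using (Fin; fromℕ; inject₁; toℕ)
import Data.Fin.Properties as Fin
open import Data.Integer as ℤ using (ℤ; +_; 0ℤ; 1ℤ; _%ℕ_; _/ℕ_)
import Data.Integer.DivMod as ℤ
import Data.Integer.Divisibility.Signed as Signed
import Data.Integer.Properties as ℤ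
open import Data.Integer.Tactic.RingSolver using (solve-∀)
open import Data.List using (upTo)
open import Data.List.Membership.Propositional using (lose)
open import Data.List.Membership.Propositional.Properties using (∈-upTo⁺)
open import Data.List.Relation.Unary.Any using (satisfied)
open import Data.List.Relation.Unary.Any.Properties using (any⁺; any⁻)
open import Data.Nat as ℕ using (ℕ; zero; suc; _≤_; _<_; _∸_; _!; z≤n; s≤s)
open import Data.Nat.Combinatorics using (nCn≡1; nCk≡n!/k![n-k]!; k![n∸k]!∣n!) renaming (_C_ to _choose_)
import Data.Nat.Coprimality as Coprime
import Data.Nat.DivMod as ℕ
open import Data.Nat.Divisibility as ℕ using (_∣_; divides)
open import Data.Nat.Induction using (<-rec)
open import Data.Nat.Primality using (Prime; euclidsLemma; prime⇒nonTrivial; prime⇒nonZero)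
import Data.Nat.Properties as ℕ
import Data.Nat.Tactic.RingSolver as ℕ-Solver
open import Data.Product using (∃-syntax; _×_; _,_; proj₁; proj₂)
open import Data.Rational as ℚ using (ℚ; mkℚ; ↥_; ↧_; ↧ₙ_; 0ℚ; 1ℚ; toℚᵘ)
import Data.Rational.Properties as ℚ
open import Data.Rational.Unnormalised as ℚᵘ using (mkℚᵘ; *≡*)
open import Data.Sum as Sum using (_⊎_; inj₁; inj₂; [_,_]′)
open import Data.Unit using (tt)
open import Data.Vec using (Vec; []; _∷_; replicate)
import Data.Vec.Functional as Vector
open import Function using (_∘_; id)
open import Level using (0ℓ)
open import Relation.Binary.PropositionalEquality as ≡
  using (_≡_; _≢_; refl; sym; trans; cong; cong₂; subst; module ≡-Reasoning)
open import Relation.Nullary using (¬_; Dec; contradiction)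
import Relation.Nullary.Decidable as Dec

-- How the two facts about G give the theorem: let `z` and `-z` both be 2^k-th powers and p̂ = l
-- 2^k. If z = w^(2^k), then z^l = w^p̂ is 1 or -1, and it is 1 exactly when z is also a 2^(k+1)-th
-- power; the same holds for -z. As (-z)^l = (-1)^l z^l, the parity of l decides. For odd l exactly
-- one of z, -z extends: z^l = 1 yields W_l = 0, and z^l = -1 yields V_l = 0. For even l both extend
-- or neither does, and in the latter case z^l = -1 with l = 2i says that z^i + z^(-i) = C_i(q)
-- vanishes. Traces spare the construction of G and its two cases. The price is that a solution `a`
-- of C_(2^k)(a) = q or -q must be shown to belong to the same G as q: a² - 4 and q² - 4 differ by a
-- nonzero square, so the Legendre symbol, and with it p̂, is the same for both.

-- Binomial coefficients modulo a prime and the Frobenius map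

1<prime : ∀ {p} → Prime p → 1 < p
1<prime pr = ℕ.nonTrivial⇒n>1 _ {{prime⇒nonTrivial pr}}

prime∤! : ∀ {p} → Prime p → ∀ n → n < p → ¬ p ∣ n !
prime∤! pr zero    n<p p∣1  = ℕ.>⇒∤ (1<prime pr) p∣1
prime∤! pr (suc n) n<p p∣n! with euclidsLemma (suc n) (n !) pr p∣n!
... | inj₁ p∣n  = ℕ.>⇒∤ n<p p∣n
... | inj₂ p∣n! = prime∤! pr n (ℕ.<⇒≤ n<p) p∣n!

prime∣choose : ∀ {p} → Prime p → ∀ k → 0 < k → k < p → p ∣ p choose k
prime∣choose {p@(suc n)} pr k@(suc j) _ k<p with euclidsLemma (p choose k) (k ! ℕ.* (p ∸ k) !) pr p∣Ckk
  where
  instance _ = k ℕ.!* (p ∸ k) !≢0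
  Ckk : (p choose k) ℕ.* (k ! ℕ.* (p ∸ k) !) ≡ p !
  Ckk = ≡.trans (cong (ℕ._* (k ! ℕ.* (p ∸ k) !)) (nCk≡n!/k![n-k]! (ℕ.<⇒≤ k<p)))
                (ℕ.m/n*n≡m (k![n∸k]!∣n! (ℕ.<⇒≤ k<p)))
  p∣Ckk : p ∣ (p choose k) ℕ.* (k ! ℕ.* (p ∸ k) !)
  p∣Ckk = subst (p ∣_) (≡.sym Ckk) (ℕ.m∣m*n (n !))
... | inj₁ p∣choose = p∣choose
... | inj₂ p∣kk with euclidsLemma (k !) ((p ∸ k) !) pr p∣kk
...   | inj₁ p∣k = contradiction p∣k (prime∤! pr k k<p)
...   | inj₂ p∣l = contradiction p∣l (prime∤! pr (p ∸ k) (s≤s (ℕ.m∸n≤m n j)))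

module Frobenius {a ℓ} (S : CommutativeSemiring a ℓ) where
  open CommutativeSemiring S
  open import Algebra.Properties.CommutativeSemiring.Exp S using (_^_)
  open import Algebra.Properties.Semiring.Mult semiring using (×-assocˡ; ×-homo-1) renaming (_×_ to _⨯_)
  open import Algebra.Properties.Semiring.Sum semiring using (sum; sum-init-last; sum-cong-≋; sum-replicate-zero)
  open import Algebra.Properties.CommutativeSemiring.Binomial S using (binomialTerm; theorem)
  open import Relation.Binary.Reasoning.Setoid setoid

  -- Stated for any commutative semiring killed by `p` because it serves twice: for the integers
  -- modulo `p`, where it gives Fermat's theorem, and for their quadratic extension.
  ^-distrib-+ : ∀ {p} → Prime p → (∀ x → p ⨯ x ≈ 0#) →
                ∀ x y → (x + y) ^ p ≈ x ^ p + y ^ p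
  ^-distrib-+ {zero} pr p⨯≈0 x y = contradiction (1<prime pr) λ ()
  ^-distrib-+ {p@(suc n)} pr p⨯≈0 x y = begin
    (x + y) ^ p                                    ≈⟨ theorem p x y ⟩
    term Fin.zero + sum (λ k → term (Fin.suc k))   ≈⟨ +-congˡ (sum-init-last (λ k → term (Fin.suc k))) ⟩
    term Fin.zero + (sum inner + term (fromℕ p))   ≈⟨ +-cong first (+-cong inner≈0 final) ⟩
    y ^ p + (0# + x ^ p)                           ≈⟨ +-congˡ (+-identityˡ _) ⟩
    y ^ p + x ^ p                                  ≈⟨ +-comm _ _ ⟩
    x ^ p + y ^ p                                  ∎
    where
    term : Fin (suc p) → Carrier
    term = binomialTerm x y p
    inner : Fin n → Carrier
    inner = Vector.init (λ k → term (Fin.suc k))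
    multiple≈0 : ∀ {m} → p ∣ m → ∀ z → m ⨯ z ≈ 0#
    multiple≈0 (divides q refl) z = begin
      (q ℕ.* p) ⨯ z ≡⟨ cong (_⨯ z) (ℕ.*-comm q p) ⟩
      (p ℕ.* q) ⨯ z ≈⟨ ×-assocˡ z p q ⟨
      p ⨯ (q ⨯ z)   ≈⟨ p⨯≈0 _ ⟩
      0#            ∎
    first : term Fin.zero ≈ y ^ p
    first = begin
      1 ⨯ (1# * y ^ p) ≈⟨ ×-homo-1 _ ⟩
      1# * y ^ p       ≈⟨ *-identityˡ _ ⟩
      y ^ p            ∎
    final : term (fromℕ p) ≈ x ^ p
    final rewrite Fin.toℕ-fromℕ n | nCn≡1 p | ℕ.n∸n≡0 n = begin
      1 ⨯ (x ^ p * 1#) ≈⟨ ×-homo-1 _ ⟩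
      x ^ p * 1#       ≈⟨ *-identityʳ _ ⟩
      x ^ p            ∎
    inner≈0 : sum inner ≈ 0#
    inner≈0 = begin
      sum inner                ≈⟨ sum-cong-≋ {n} {inner} {Vector.replicate n 0#} (λ k → multiple≈0 (prime∣choose pr (toℕ (Fin.suc (inject₁ k)))
                                  (s≤s z≤n) (s≤s (subst (_< n) (≡.sym (Fin.toℕ-inject₁ k)) (Fin.toℕ<n k)))) _) ⟩
      sum (Vector.replicate n 0#)     ≈⟨ sum-replicate-zero n ⟩
      0#                       ∎

-- Parity and powers of two

parity : ∀ n → (∃[ i ] n ≡ i ℕ.+ i) ⊎ (∃[ i ] n ≡ suc (i ℕ.+ i))
parity zero    = inj₁ (0 , refl)
parity (suc n) with parity n
... | inj₁ (i , refl) = inj₂ (i , refl)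
... | inj₂ (i , refl) = inj₁ (suc i , cong suc (sym (ℕ.+-suc i i)))

even≢odd : ∀ i j → i ℕ.+ i ≢ suc (j ℕ.+ j)
even≢odd (suc i) zero    eq = ℕ.0≢1+n (sym (trans (sym (ℕ.+-suc i i)) (ℕ.suc-injective eq)))
even≢odd (suc i) (suc j) eq = even≢odd i j (ℕ.suc-injective (trans (sym (ℕ.+-suc i i))
  (trans (ℕ.suc-injective eq) (cong suc (ℕ.+-suc j j)))))

-- Brings the index of a vanishing Chebyshev value into the form that `Π` demands; the exponent `j`
-- then selects the set with number `j + 2`.
2-adic : ∀ n → n ≢ 0 → ∃[ j ] ∃[ i ] n ≡ 2 ℕ.^ j ℕ.* (2 ℕ.* i ℕ.+ 1)
2-adic = <-rec _ step
  where
  double : ∀ x y → x ℕ.* y ℕ.+ x ℕ.* y ≡ (x ℕ.+ (x ℕ.+ 0)) ℕ.* y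
  double = ℕ-Solver.solve-∀
  odd : ∀ i → suc (i ℕ.+ i) ≡ 1 ℕ.* (2 ℕ.* i ℕ.+ 1)
  odd = ℕ-Solver.solve-∀
  step : ∀ n → (∀ {m} → m < n → m ≢ 0 → ∃[ j ] ∃[ i ] m ≡ 2 ℕ.^ j ℕ.* (2 ℕ.* i ℕ.+ 1)) →
         n ≢ 0 → ∃[ j ] ∃[ i ] n ≡ 2 ℕ.^ j ℕ.* (2 ℕ.* i ℕ.+ 1)
  step n rec n≢0 with parity n
  ... | inj₂ (i , refl)     = 0 , i , odd i
  ... | inj₁ (zero , refl)  = contradiction refl n≢0
  ... | inj₁ (suc m , refl) with rec (ℕ.m<m+n (suc m) (s≤s z≤n)) (λ ())
  ...   | j , i , eq = suc j , i , trans (cong₂ ℕ._+_ eq eq) (double (2 ℕ.^ j) (2 ℕ.* i ℕ.+ 1))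

half≡double : ∀ {h k} i → h ≡ (i ℕ.+ i) ℕ.* 2 ℕ.^ k → h ≡ i ℕ.* 2 ℕ.^ suc k
half≡double {h} {k} i h≡ = trans h≡ (eq i (2 ℕ.^ k))
  where
  eq : ∀ i x → (i ℕ.+ i) ℕ.* x ≡ i ℕ.* (2 ℕ.* x)
  eq = ℕ-Solver.solve-∀

double≡ : ∀ {h k} l → h ≡ l ℕ.* 2 ℕ.^ k → h ℕ.+ h ≡ l ℕ.* 2 ℕ.^ suc k
double≡ {h} {k} l h≡ = trans (cong₂ ℕ._+_ h≡ h≡) (eq l (2 ℕ.^ k))
  where
  eq : ∀ l x → l ℕ.* x ℕ.+ l ℕ.* x ≡ l ℕ.* (2 ℕ.* x)
  eq = ℕ-Solver.solve-∀

odd-multiple⇒∤ : ∀ {h k} i → h ≡ suc (i ℕ.+ i) ℕ.* 2 ℕ.^ k → ¬ 2 ℕ.^ suc k ∣ h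
odd-multiple⇒∤ {h} {k} i h≡ (divides r h≡r) =
  even≢odd r i (ℕ.*-cancelʳ-≡ (r ℕ.+ r) (suc (i ℕ.+ i)) (2 ℕ.^ k) (trans (sym (trans h≡r (eq r (2 ℕ.^ k)))) h≡))
  where
  instance _ = ℕ.m^n≢0 2 k
  eq : ∀ r x → r ℕ.* (2 ℕ.* x) ≡ (r ℕ.+ r) ℕ.* x
  eq = ℕ-Solver.solve-∀

half-double : ∀ i → (i ℕ.+ i) ℕ./ 2 ≡ i
half-double i = trans (cong (ℕ._/ 2) (eq i)) (ℕ.m*n/n≡m i 2)
  where
  eq : ∀ i → i ℕ.+ i ≡ i ℕ.* 2
  eq = ℕ-Solver.solve-∀

half-odd : ∀ i → (2 ℕ.* i ℕ.+ 1) ℕ./ 2 ≡ i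
half-odd i = trans (cong (ℕ._/ 2) (eq i)) (trans (ℕ.+-distrib-/-∣ʳ 1 {i ℕ.* 2} {2} (divides i refl)) (ℕ.m*n/n≡m i 2))
  where
  eq : ∀ i → 2 ℕ.* i ℕ.+ 1 ≡ 1 ℕ.+ i ℕ.* 2
  eq = ℕ-Solver.solve-∀

odd-prime : ∀ {p} → OddPrime p → ∃[ m ] p ≡ suc (m ℕ.+ m)
odd-prime {p} (_ , 2∤p) with parity p
... | inj₁ (m , refl) = contradiction (divides m (eq m)) 2∤p
  where
  eq : ∀ m → m ℕ.+ m ≡ m ℕ.* 2
  eq = ℕ-Solver.solve-∀
... | inj₂ odd = odd

module ChebyshevCongruences where
  open import Data.Integer using (_+_; _*_; _-_; -_)

  -- Chebyshev polynomials at integers and their identities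

  -- Integers stand for residues modulo `p`, so the identities below are exact and congruences enter
  -- only later; `↦-U` and `↦-C` link these values to the rational ones.
  u : ℕ → ℤ → ℤ
  u zero          a = 0ℤ
  u (suc zero)    a = 1ℤ
  u (suc (suc n)) a = a * u (suc n) a - u n a

  c : ℕ → ℤ → ℤ
  c zero    a = + 2
  c (suc n) a = u (suc (suc n)) a - u n a

  module ChebyshevIdentities where
    open ≡-Reasoning

    -- Eliminates `u (n - 1)`, so that later identities need no separate case `n = 0`. The right
    -- side is the trace of z^n when z² = a z - 1.
    c≡2u-au : ∀ n a → c n a ≡ + 2 * u (suc n) a - a * u n a
    c≡2u-au zero    a = eq a
      where
      eq : ∀ a → + 2 ≡ + 2 * 1ℤ - a * 0ℤ
      eq = solve-∀
    c≡2u-au (suc n) a = eq a (u n a) (u (suc n) a)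
      where
      eq : ∀ a v w → a * w - v - v ≡ + 2 * (a * w - v) - a * w
      eq = solve-∀

    c₁ : ∀ a → c 1 a ≡ a
    c₁ = eq
      where
      eq : ∀ a → a * 1ℤ - 0ℤ - 0ℤ ≡ a
      eq = solve-∀

    c₂ : ∀ a → c 2 a ≡ a * a - + 2
    c₂ = eq
      where
      eq : ∀ a → a * (a * 1ℤ - 0ℤ) - 1ℤ - 1ℤ ≡ a * a - + 2
      eq = solve-∀

    c-rec : ∀ n a → c (suc (suc n)) a ≡ a * c (suc n) a - c n a
    c-rec zero    a = eq a
      where
      eq : ∀ a → a * (a * 1ℤ - 0ℤ) - 1ℤ - 1ℤ ≡ a * (a * 1ℤ - 0ℤ - 0ℤ) - + 2
      eq = solve-∀
    c-rec (suc n) a = eq a (u n a) (u (suc n) a)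
      where
      eq : ∀ a v w → a * (a * (a * w - v) - w) - (a * w - v) - (a * w - v) ≡
                     a * (a * (a * w - v) - w - w) - (a * w - v - v)
      eq = solve-∀

    -- The left side is the norm of z^n for a root z of z² - a z + 1, and z has norm 1.
    cassini : ∀ n a → u (suc n) a * u (suc n) a - a * u n a * u (suc n) a + u n a * u n a ≡ 1ℤ
    cassini zero    a = eq a
      where
      eq : ∀ a → 1ℤ * 1ℤ - a * 0ℤ * 1ℤ + 0ℤ * 0ℤ ≡ 1ℤ
      eq = solve-∀
    cassini (suc n) a = trans (eq a (u n a) (u (suc n) a)) (cassini n a)
      where
      eq : ∀ a v w → (a * w - v) * (a * w - v) - a * w * (a * w - v) + w * w ≡ w * w - a * v * w + v * v
      eq = solve-∀

    -- For a = z + 1/z, the left side is (z^n - z^(-n))², and `u n a` is the quotient of z^n -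
    -- z^(-n) by z - 1/z.
    c²-4 : ∀ n a → c n a * c n a - + 4 ≡ u n a * u n a * (a * a - + 4)
    c²-4 n a = begin
      c n a * c n a - + 4                              ≡⟨ cong (λ x → x * x - + 4) (c≡2u-au n a) ⟩
      (+ 2 * w - a * v) * (+ 2 * w - a * v) - + 4      ≡⟨ eq a v w ⟩
      v * v * (a * a - + 4) + + 4 * (K - 1ℤ)           ≡⟨ cong (λ k → v * v * (a * a - + 4) + + 4 * (k - 1ℤ)) (cassini n a) ⟩
      v * v * (a * a - + 4) + 0ℤ                       ≡⟨ ℤ.+-identityʳ _ ⟩
      v * v * (a * a - + 4)                            ∎
      where
      v = u n a
      w = u (suc n) a
      K = w * w - a * v * w + v * v
      eq : ∀ a v w → (+ 2 * w - a * v) * (+ 2 * w - a * v) - + 4 ≡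
                     v * v * (a * a - + 4) + + 4 * (w * w - a * v * w + v * v - 1ℤ)
      eq = solve-∀

    -- The product (z^n + z^(-n)) (z^s + z^(-s)) multiplied out. The smaller index `j` is the
    -- parameter, which avoids the truncated difference `s - n`.
    c-product : ∀ n j a {s t} → s ≡ j ℕ.+ n → t ≡ s ℕ.+ n → c t a + c j a ≡ c n a * c s a
    c-product zero j a {s} refl refl = trans (cong₂ _+_ (cong (λ i → c i a) (ℕ.+-identityʳ s)) (cong (λ i → c i a) (sym (ℕ.+-identityʳ j)))) (eq (c s a))
      where
      eq : ∀ x → x + x ≡ + 2 * x
      eq = solve-∀
    c-product (suc zero) j a {s} {t} s≡ t≡ = begin
      c t a + c j a                            ≡⟨ cong (λ i → c i a + c j a) t≡2+j ⟩
      c (suc (suc j)) a + c j a                ≡⟨ cong (_+ c j a) (c-rec j a) ⟩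
      a * c (suc j) a - c j a + c j a          ≡⟨ eq a (c (suc j) a) (c j a) ⟩
      a * c (suc j) a                          ≡⟨ cong₂ _*_ (sym (c₁ a)) (cong (λ i → c i a) (sym s≡1+j)) ⟩
      c 1 a * c s a                            ∎
      where
      eq : ∀ a x y → a * x - y + y ≡ a * x
      eq = solve-∀
      s≡1+j : s ≡ suc j
      s≡1+j = trans s≡ (ℕ.+-comm j 1)
      t≡2+j : t ≡ suc (suc j)
      t≡2+j = trans t≡ (trans (ℕ.+-comm s 1) (cong suc s≡1+j))
    c-product (suc (suc n)) j a {s} {t} s≡ t≡ = begin
      c t a + c j a                                             ≡⟨ cong (λ i → c i a + c j a) t≡4+t₀ ⟩
      c (4 ℕ.+ t₀) a + c j a                                    ≡⟨ cong (_+ c j a) (c-rec (2 ℕ.+ t₀) a) ⟩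
      a * c (3 ℕ.+ t₀) a - c (2 ℕ.+ t₀) a + c j a               ≡⟨ eq₁ a (c (3 ℕ.+ t₀) a) (c (2 ℕ.+ t₀) a) (c (suc j) a) (c j a) ⟩
      -- The upper term has been unrolled downwards; the lower one is now run upwards, as
      -- `c j = a c (j + 1) - c (j + 2)`. The two resulting pairs share the middle index `s`, and
      -- the induction hypotheses for `n + 1` and `n` apply.
      a * (c (3 ℕ.+ t₀) a + c (suc j) a) -
        (c (2 ℕ.+ t₀) a + (a * c (suc j) a - c j a))            ≡⟨ cong (λ x → a * (c (3 ℕ.+ t₀) a + c (suc j) a) - (c (2 ℕ.+ t₀) a + x)) (c-rec j a) ⟨
      a * (c (3 ℕ.+ t₀) a + c (suc j) a) -
        (c (2 ℕ.+ t₀) a + c (suc (suc j)) a)                    ≡⟨ cong₂ (λ x y → a * x - y)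
                                                                     (c-product (suc n) (suc j) a (shift₁ j n) (shift₂ j n))
                                                                     (c-product n (suc (suc j)) a refl refl) ⟩
      a * (c (suc n) a * c (2 ℕ.+ s₀) a) - c n a * c (2 ℕ.+ s₀) a  ≡⟨ eq₂ a (c (suc n) a) (c n a) (c (2 ℕ.+ s₀) a) ⟩
      (a * c (suc n) a - c n a) * c (2 ℕ.+ s₀) a                ≡⟨ cong₂ _*_ (sym (c-rec n a)) (cong (λ i → c i a) (sym s≡2+s₀)) ⟩
      c (suc (suc n)) a * c s a                                 ∎
      where
      s₀ = j ℕ.+ n
      t₀ = s₀ ℕ.+ n
      shift₁ : ∀ j n → 2 ℕ.+ (j ℕ.+ n) ≡ suc j ℕ.+ suc n
      shift₁ = ℕ-Solver.solve-∀
      shift₂ : ∀ j n → 3 ℕ.+ (j ℕ.+ n ℕ.+ n) ≡ 2 ℕ.+ (j ℕ.+ n) ℕ.+ suc n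
      shift₂ = ℕ-Solver.solve-∀
      s≡2+s₀ : s ≡ 2 ℕ.+ s₀
      s≡2+s₀ = trans s≡ (eq j n)
        where
        eq : ∀ j n → j ℕ.+ suc (suc n) ≡ 2 ℕ.+ (j ℕ.+ n)
        eq = ℕ-Solver.solve-∀
      t≡4+t₀ : t ≡ 4 ℕ.+ t₀
      t≡4+t₀ = trans t≡ (trans (cong (ℕ._+ suc (suc n)) s≡2+s₀) (eq j n))
        where
        eq : ∀ j n → 2 ℕ.+ (j ℕ.+ n) ℕ.+ suc (suc n) ≡ 4 ℕ.+ (j ℕ.+ n ℕ.+ n)
        eq = ℕ-Solver.solve-∀
      eq₁ : ∀ a x y v w → a * x - y + w ≡ a * (x + v) - (y + (a * v - w))
      eq₁ = solve-∀
      eq₂ : ∀ a x y v → a * (x * v) - y * v ≡ (a * x - y) * v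
      eq₂ = solve-∀

    c-double : ∀ n a → c (n ℕ.+ n) a ≡ c n a * c n a - + 2
    c-double n a = trans (shift (c (n ℕ.+ n) a)) (cong (_- + 2) (c-product n 0 a refl refl))
      where
      shift : ∀ x → x ≡ x + + 2 - + 2
      shift = solve-∀

    -- In `m` both sides obey the recurrence with multiplier `c n a`; for the left side this is
    -- `c-product`. It lets a value at `x` be computed at a root `a` of C_(2^k)(a) = x.
    c-∘ : ∀ m n a → c (m ℕ.* n) a ≡ c m (c n a)
    c-∘ zero          n a = refl
    c-∘ (suc zero)    n a = trans (cong (λ i → c i a) (ℕ.+-identityʳ n)) (sym (c₁ (c n a)))
    c-∘ (suc (suc m)) n a = begin
      c (suc (suc m) ℕ.* n) a                            ≡⟨ shift (c (suc (suc m) ℕ.* n) a) (c (m ℕ.* n) a) ⟩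
      c (suc (suc m) ℕ.* n) a + c (m ℕ.* n) a - c (m ℕ.* n) a
        ≡⟨ cong (_- c (m ℕ.* n) a) (c-product n (m ℕ.* n) a {suc m ℕ.* n} (ℕ.+-comm n (m ℕ.* n)) (ℕ.+-comm n (suc m ℕ.* n))) ⟩
      c n a * c (suc m ℕ.* n) a - c (m ℕ.* n) a          ≡⟨ cong₂ (λ x y → c n a * x - y) (c-∘ (suc m) n a) (c-∘ m n a) ⟩
      c n a * c (suc m) (c n a) - c m (c n a)            ≡⟨ c-rec m (c n a) ⟨
      c (suc (suc m)) (c n a)                            ∎
      where
      shift : ∀ x y → x ≡ x + y - y
      shift = solve-∀

    -- Each parity feeds the next in the recurrence, hence the joint induction. The sign for odd
    -- indices is what distinguishes `q` from `- q` below.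
    c-neg : ∀ j a → c (j ℕ.+ j) (- a) ≡ c (j ℕ.+ j) a × c (suc (j ℕ.+ j)) (- a) ≡ - c (suc (j ℕ.+ j)) a
    c-neg zero    a = refl , trans (c₁ (- a)) (cong -_ (sym (c₁ a)))
    c-neg (suc j) a rewrite ℕ.+-suc j j = even , odd
      where
      n = j ℕ.+ j
      eq₁ : ∀ a x y → - a * - x - y ≡ a * x - y
      eq₁ = solve-∀
      eq₂ : ∀ a x y → - a * x - - y ≡ - (a * x - y)
      eq₂ = solve-∀
      even : c (2 ℕ.+ n) (- a) ≡ c (2 ℕ.+ n) a
      even = begin
        c (2 ℕ.+ n) (- a)                         ≡⟨ c-rec n (- a) ⟩
        - a * c (suc n) (- a) - c n (- a)         ≡⟨ cong₂ (λ x y → - a * x - y) (proj₂ (c-neg j a)) (proj₁ (c-neg j a)) ⟩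
        - a * - c (suc n) a - c n a               ≡⟨ eq₁ a (c (suc n) a) (c n a) ⟩
        a * c (suc n) a - c n a                   ≡⟨ c-rec n a ⟨
        c (2 ℕ.+ n) a                             ∎
      odd : c (3 ℕ.+ n) (- a) ≡ - c (3 ℕ.+ n) a
      odd = begin
        c (3 ℕ.+ n) (- a)                         ≡⟨ c-rec (suc n) (- a) ⟩
        - a * c (2 ℕ.+ n) (- a) - c (suc n) (- a) ≡⟨ cong₂ (λ x y → - a * x - y) even (proj₂ (c-neg j a)) ⟩
        - a * c (2 ℕ.+ n) a - - c (suc n) a       ≡⟨ eq₂ a (c (2 ℕ.+ n) a) (c (suc n) a) ⟩
        - (a * c (2 ℕ.+ n) a - c (suc n) a)       ≡⟨ cong -_ (c-rec (suc n) a) ⟨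
        - c (3 ℕ.+ n) a                           ∎

    module _ (j : ℕ) (a : ℤ) where
      private
        v = u j a
        w = u (suc j) a
        K = w * w - a * v * w + v * v

      c-odd : c (suc (j ℕ.+ j)) a ≡ (+ 2 * w - a * v) * (a * w - + 2 * v) - a
      c-odd = begin
        c (suc (j ℕ.+ j)) a                                          ≡⟨ shift a (c (suc (j ℕ.+ j)) a) ⟩
        c (suc (j ℕ.+ j)) a + a - a                                  ≡⟨ cong (λ x → c (suc (j ℕ.+ j)) a + x - a) (c₁ a) ⟨
        c (suc (j ℕ.+ j)) a + c 1 a - a                              ≡⟨ cong (_- a) (c-product j 1 a refl refl) ⟩
        c j a * c (suc j) a - a                                      ≡⟨ cong (λ x → x * c (suc j) a - a) (c≡2u-au j a) ⟩
        (+ 2 * w - a * v) * (a * w - v - v) - a                      ≡⟨ regroup a v w ⟩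
        (+ 2 * w - a * v) * (a * w - + 2 * v) - a                    ∎
        where
        shift : ∀ a x → x ≡ x + a - a
        shift = solve-∀
        regroup : ∀ a v w → (+ 2 * w - a * v) * (a * w - v - v) - a ≡ (+ 2 * w - a * v) * (a * w - + 2 * v) - a
        regroup = solve-∀

      -- Put n = 2j + 1 and a = t² + t^(-2). Then c_n - 2 = (t^n - t^(-n))², a - 2 = (t - 1/t)², and
      -- `w + v`, which is W_n, is the quotient of t^n - t^(-n) by t - 1/t. With plus signs
      -- throughout, the same computation gives V_n in `c-odd+2`.
      c-odd-2 : c (suc (j ℕ.+ j)) a - + 2 ≡ (a - + 2) * ((w + v) * (w + v))
      c-odd-2 = begin
        c (suc (j ℕ.+ j)) a - + 2                                     ≡⟨ cong (_- + 2) c-odd ⟩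
        (+ 2 * w - a * v) * (a * w - + 2 * v) - a - + 2               ≡⟨ eq a v w ⟩
        (a - + 2) * ((w + v) * (w + v)) + (a + + 2) * (K - 1ℤ)        ≡⟨ cong (λ k → (a - + 2) * ((w + v) * (w + v)) + (a + + 2) * (k - 1ℤ)) (cassini j a) ⟩
        (a - + 2) * ((w + v) * (w + v)) + (a + + 2) * 0ℤ              ≡⟨ drop ((a - + 2) * ((w + v) * (w + v))) (a + + 2) ⟩
        (a - + 2) * ((w + v) * (w + v))                               ∎
        where
        eq : ∀ a v w → (+ 2 * w - a * v) * (a * w - + 2 * v) - a - + 2 ≡
                       (a - + 2) * ((w + v) * (w + v)) + (a + + 2) * (w * w - a * v * w + v * v - 1ℤ)
        eq = solve-∀
        drop : ∀ x y → x + y * 0ℤ ≡ x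
        drop = solve-∀

      c-odd+2 : c (suc (j ℕ.+ j)) a + + 2 ≡ (a + + 2) * ((w - v) * (w - v))
      c-odd+2 = begin
        c (suc (j ℕ.+ j)) a + + 2                                     ≡⟨ cong (_+ + 2) c-odd ⟩
        (+ 2 * w - a * v) * (a * w - + 2 * v) - a + + 2               ≡⟨ eq a v w ⟩
        (a + + 2) * ((w - v) * (w - v)) + (a - + 2) * (K - 1ℤ)        ≡⟨ cong (λ k → (a + + 2) * ((w - v) * (w - v)) + (a - + 2) * (k - 1ℤ)) (cassini j a) ⟩
        (a + + 2) * ((w - v) * (w - v)) + (a - + 2) * 0ℤ              ≡⟨ drop ((a + + 2) * ((w - v) * (w - v))) (a - + 2) ⟩
        (a + + 2) * ((w - v) * (w - v))                               ∎
        where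
        eq : ∀ a v w → (+ 2 * w - a * v) * (a * w - + 2 * v) - a + + 2 ≡
                       (a + + 2) * ((w - v) * (w - v)) + (a - + 2) * (w * w - a * v * w + v * v - 1ℤ)
        eq = solve-∀
        drop : ∀ x y → x + y * 0ℤ ≡ x
        drop = solve-∀

  open ChebyshevIdentities

  -- Congruence of integers modulo p

  module Modulo (p : ℕ) where

    infix 4 _≈_ _≉_

    -- With the quotient kept as data, matching the equation with `refl` turns each congruence law
    -- into a ring identity for the solver.
    record _≈_ (x y : ℤ) : Set where
      constructor _by_
      field
        quotient : ℤ
        equality : x ≡ y + quotient * + p

    _≉_ : ℤ → ℤ → Set
    x ≉ y = ¬ x ≈ y

    ≈-reflexive : ∀ {x y} → x ≡ y → x ≈ y
    ≈-reflexive {x} refl = 0ℤ by eq x (+ p)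
      where
      eq : ∀ x p → x ≡ x + 0ℤ * p
      eq = solve-∀

    ≈-refl : ∀ {x} → x ≈ x
    ≈-refl = ≈-reflexive refl

    ≈-sym : ∀ {x y} → x ≈ y → y ≈ x
    ≈-sym {y = y} (q by refl) = (- q) by eq y q (+ p)
      where
      eq : ∀ y q p → y ≡ y + q * p + - q * p
      eq = solve-∀

    ≈-trans : ∀ {x y z} → x ≈ y → y ≈ z → x ≈ z
    ≈-trans {z = z} (q by refl) (r by refl) = (q + r) by eq z q r (+ p)
      where
      eq : ∀ z q r p → z + r * p + q * p ≡ z + (q + r) * p
      eq = solve-∀

    +-mono : ∀ {x y u v} → x ≈ y → u ≈ v → x + u ≈ y + v
    +-mono {y = y} {v = v} (q by refl) (r by refl) = (q + r) by eq y v q r (+ p)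
      where
      eq : ∀ y v q r p → y + q * p + (v + r * p) ≡ y + v + (q + r) * p
      eq = solve-∀

    *-mono : ∀ {x y u v} → x ≈ y → u ≈ v → x * u ≈ y * v
    *-mono {y = y} {v = v} (q by refl) (r by refl) =
      (y * r + q * v + q * r * + p) by eq y v q r (+ p)
      where
      eq : ∀ y v q r p → (y + q * p) * (v + r * p) ≡ y * v + (y * r + q * v + q * r * p) * p
      eq = solve-∀

    -‿mono : ∀ {x y} → x ≈ y → - x ≈ - y
    -‿mono {y = y} (q by refl) = (- q) by eq y q (+ p)
      where
      eq : ∀ y q p → - (y + q * p) ≡ - y + - q * p
      eq = solve-∀

    +-monoʳ : ∀ x {y z} → y ≈ z → x + y ≈ x + z
    +-monoʳ x = +-mono (≈-refl {x})

    +-monoˡ : ∀ x {y z} → y ≈ z → y + x ≈ z + x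
    +-monoˡ x y≈z = +-mono y≈z (≈-refl {x})

    *-monoʳ : ∀ x {y z} → y ≈ z → x * y ≈ x * z
    *-monoʳ x = *-mono (≈-refl {x})

    *-monoˡ : ∀ x {y z} → y ≈ z → y * x ≈ z * x
    *-monoˡ x y≈z = *-mono y≈z (≈-refl {x})

    ℤ/ : CommutativeRing 0ℓ 0ℓ
    ℤ/ = record
      { _≈_ = _≈_
      ; _+_ = _+_
      ; _*_ = _*_
      ; -_ = -_
      ; 0# = 0ℤ
      ; 1# = 1ℤ
      ; isCommutativeRing = record
        { isRing = record
          { +-isAbelianGroup = record
            { isGroup = record
              { isMonoid = record
                { isSemigroup = record
                  { isMagma = record
                    { isEquivalence = record { refl = ≈-reflexive refl ; sym = ≈-sym ; trans = ≈-trans }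
                    ; ∙-cong = +-mono
                    }
                  ; assoc = λ x y z → ≈-reflexive (ℤ.+-assoc x y z)
                  }
                ; identity = (λ x → ≈-reflexive (ℤ.+-identityˡ x)) , (λ x → ≈-reflexive (ℤ.+-identityʳ x))
                }
              ; inverse = (λ x → ≈-reflexive (ℤ.+-inverseˡ x)) , (λ x → ≈-reflexive (ℤ.+-inverseʳ x))
              ; ⁻¹-cong = -‿mono
              }
            ; comm = λ x y → ≈-reflexive (ℤ.+-comm x y)
            }
          ; *-cong = *-mono
          ; *-assoc = λ x y z → ≈-reflexive (ℤ.*-assoc x y z)
          ; *-identity = (λ x → ≈-reflexive (ℤ.*-identityˡ x)) , (λ x → ≈-reflexive (ℤ.*-identityʳ x))
          ; distrib = (λ x y z → ≈-reflexive (ℤ.*-distribˡ-+ x y z)) , (λ x y z → ≈-reflexive (ℤ.*-distribʳ-+ x y z))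
          }
        ; *-comm = λ x y → ≈-reflexive (ℤ.*-comm x y)
        }
      }

    ≈0⇒∣ : ∀ {x} → x ≈ 0ℤ → p ∣ ℤ.∣ x ∣
    ≈0⇒∣ (q by eq) = divides ℤ.∣ q ∣ (trans (cong ℤ.∣_∣ (trans eq (ℤ.+-identityˡ (q * + p)))) (ℤ.abs-* q (+ p)))

    ∣⇒≈0 : ∀ {x} → p ∣ ℤ.∣ x ∣ → x ≈ 0ℤ
    ∣⇒≈0 p∣x with Signed.∣ᵤ⇒∣ p∣x
    ... | Signed.divides q eq = q by trans eq (sym (ℤ.+-identityˡ _))

    -≈0⇒≈ : ∀ {x y} → x - y ≈ 0ℤ → x ≈ y
    -≈0⇒≈ {x} {y} (q by eq) = q by trans (shift x y) (cong (_+_ y) (trans eq (ℤ.+-identityˡ _)))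
      where
      shift : ∀ x y → x ≡ y + (x - y)
      shift = solve-∀

    ≈⇒-≈0 : ∀ {x y} → x ≈ y → x - y ≈ 0ℤ
    ≈⇒-≈0 {y = y} (q by refl) = q by eq y q (+ p)
      where
      eq : ∀ y q p → y + q * p - y ≡ 0ℤ + q * p
      eq = solve-∀

    infix 4 _≈?_

    _≈?_ : ∀ x y → Dec (x ≈ y)
    x ≈? y = Dec.map′ (-≈0⇒≈ ∘ ∣⇒≈0) (≈0⇒∣ ∘ ≈⇒-≈0) (p ℕ.∣? ℤ.∣ x - y ∣)

    residue : .{{_ : ℕ.NonZero p}} → ∀ x → x ≈ + (x %ℕ p)
    residue x = (x /ℕ p) by ℤ.a≡a%ℕn+[a/ℕn]*n x p

    ≤∧≈⇒≡ : ∀ {i j} → i ≤ j → j < p → + j ≈ + i → i ≡ j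
    ≤∧≈⇒≡ {i} {j} i≤j j<p j≈i with j ℕ.∸ i in eq
    ... | zero  = ℕ.≤-antisym i≤j (ℕ.m∸n≡0⇒m≤n eq)
    ... | suc d = contradiction
      (subst (p ∣_) (trans (cong ℤ.∣_∣ (trans (ℤ.m-n≡m⊖n j i) (ℤ.⊖-≥ i≤j))) eq) (≈0⇒∣ (≈⇒-≈0 j≈i)))
      (ℕ.>⇒∤ (subst (_< p) eq (ℕ.≤-<-trans (ℕ.m∸n≤m j i) j<p)))

    ≈⇒≡ : ∀ {i j} → i < p → j < p → + i ≈ + j → i ≡ j
    ≈⇒≡ {i} {j} i<p j<p i≈j with ℕ.≤-total i j
    ... | inj₁ i≤j = ≤∧≈⇒≡ i≤j j<p (≈-sym i≈j)
    ... | inj₂ j≤i = sym (≤∧≈⇒≡ j≤i i<p i≈j)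

    open CommutativeRing ℤ/ using (commutativeSemiring; semiring) public
    open import Algebra.Properties.CommutativeSemiring.Exp commutativeSemiring
      using (_^_; ^-congˡ; ^-distrib-*; ^-homo-*) public
    open import Algebra.Properties.Semiring.Mult semiring using () renaming (_×_ to _⨯_) public

    ⨯≡* : ∀ n x → n ⨯ x ≡ + n * x
    ⨯≡* zero    x = refl
    ⨯≡* (suc n) x = trans (cong (_+_ x) (⨯≡* n x)) (sym (ℤ.suc-* (+ n) x))

    p⨯≈0 : ∀ x → p ⨯ x ≈ 0ℤ
    p⨯≈0 x = x by trans (⨯≡* p x) (trans (ℤ.*-comm (+ p) x) (sym (ℤ.+-identityˡ _)))

  -- The prime field: Fermat's theorem, roots of polynomials, Euler's criterion

  module PrimeModulo {p : ℕ} (prime : Prime p) where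
    open Modulo p
    open CommutativeRing ℤ/ using (setoid)
    
    open import Relation.Binary.Reasoning.Setoid setoid
    private instance _ = prime⇒nonZero prime

    zero-product : ∀ x y → x * y ≈ 0ℤ → x ≈ 0ℤ ⊎ y ≈ 0ℤ
    zero-product x y xy≈0 with euclidsLemma ℤ.∣ x ∣ ℤ.∣ y ∣ prime (subst (p ∣_) (ℤ.abs-* x y) (≈0⇒∣ xy≈0))
    ... | inj₁ p∣x = inj₁ (∣⇒≈0 p∣x)
    ... | inj₂ p∣y = inj₂ (∣⇒≈0 p∣y)

    *-cancelˡ : ∀ x {y z} → x ≉ 0ℤ → x * y ≈ x * z → y ≈ z
    *-cancelˡ x {y} {z} x≉0 xy≈xz = [ (λ x≈0 → contradiction x≈0 x≉0) , -≈0⇒≈ ]′ (zero-product x (y - z) product≈0)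
      where
      distrib : ∀ x y z → x * (y - z) ≡ x * y - x * z
      distrib = solve-∀
      product≈0 : x * (y - z) ≈ 0ℤ
      product≈0 = ≈-trans (≈-reflexive (distrib x y z)) (≈⇒-≈0 xy≈xz)

    1≉0 : 1ℤ ≉ 0ℤ
    1≉0 1≈0 = ℕ.>⇒∤ (1<prime prime) (≈0⇒∣ 1≈0)

    *-nonzero : ∀ {x y} → x ≉ 0ℤ → y ≉ 0ℤ → x * y ≉ 0ℤ
    *-nonzero {x} {y} x≉0 y≉0 xy≈0 with zero-product x y xy≈0
    ... | inj₁ x≈0 = x≉0 x≈0
    ... | inj₂ y≈0 = y≉0 y≈0

    square≈square : ∀ x y → x * x ≈ y * y → x ≈ y ⊎ x + y ≈ 0ℤ
    square≈square x y xx≈yy = Sum.map₁ -≈0⇒≈ (zero-product (x - y) (x + y) product≈0)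
      where
      factor : ∀ x y → (x - y) * (x + y) ≡ x * x - y * y
      factor = solve-∀
      product≈0 : (x - y) * (x + y) ≈ 0ℤ
      product≈0 = ≈-trans (≈-reflexive (factor x y)) (≈⇒-≈0 xx≈yy)

    square≈1 : ∀ x → x * x ≈ 1ℤ → x ≈ 1ℤ ⊎ x ≈ - 1ℤ
    square≈1 x xx≈1 = Sum.map₂ -≈0⇒≈ (square≈square x 1ℤ xx≈1)

    1^≈1 : ∀ n → 1ℤ ^ n ≈ 1ℤ
    1^≈1 zero    = ≈-refl
    1^≈1 (suc n) = ≈-trans (≈-reflexive (ℤ.*-identityˡ _)) (1^≈1 n)

    -- The p-th power is additive and fixes 1, so it fixes every sum of ones.
    fermat-ℕ : ∀ n → (+ n) ^ p ≈ + n
    fermat-ℕ zero    = 0^ (1<prime prime)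
      where
      0^ : ∀ {m} → 1 < m → 0ℤ ^ m ≈ 0ℤ
      0^ {suc m} _ = ≈-refl
    fermat-ℕ (suc n) = begin
      (1ℤ + + n) ^ p     ≈⟨ Frobenius.^-distrib-+ commutativeSemiring prime p⨯≈0 1ℤ (+ n) ⟩
      1ℤ ^ p + (+ n) ^ p   ≈⟨ +-mono (1^≈1 p) (fermat-ℕ n) ⟩
      1ℤ + + n           ∎

    fermat : ∀ x → x ^ p ≈ x
    fermat x = begin
      x ^ p              ≈⟨ ^-congˡ p (residue x) ⟩
      (+ (x %ℕ p)) ^ p   ≈⟨ fermat-ℕ (x %ℕ p) ⟩
      + (x %ℕ p)         ≈⟨ residue x ⟨
      x                  ∎

    -- A coefficient vector of length d stands for the monic polynomial of degree d
    -- with these lower coefficients.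

    eval : ∀ {d} → Vec ℤ d → ℤ → ℤ
    eval []       x = 1ℤ
    eval (c ∷ cs) x = c + x * eval cs x

    -- The second polynomial has degree one less, so the sum is still monic.
    add-multiple : ∀ {d} (fs : Vec ℤ (suc d)) (r : ℤ) (gs : Vec ℤ d) →
                   ∃[ hs ] (∀ x → eval {suc d} hs x ≡ eval fs x + r * eval gs x)
    add-multiple (f ∷ []) r [] = (f + r) ∷ [] , eq f r
      where
      eq : ∀ f r x → f + r + x * 1ℤ ≡ f + x * 1ℤ + r * 1ℤ
      eq = solve-∀
    add-multiple (f ∷ fs) r (g ∷ gs) with add-multiple fs r gs
    ... | hs , hs≡ = (f + r * g) ∷ hs ,
                     λ x → trans (cong (λ h → f + r * g + x * h) (hs≡ x)) (eq f r g x (eval fs x) (eval gs x))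
      where
      eq : ∀ f r g x F G → f + r * g + x * (F + r * G) ≡ f + x * F + r * (g + x * G)
      eq = solve-∀

    -- For f + x F(x) with F(x) = F(r) + (x - r) G(x), the quotient by x - r is F(x) + r G(x), which
    -- `add-multiple` supplies in monic form.
    factor-theorem : ∀ {d} (fs : Vec ℤ (suc d)) r →
                     ∃[ gs ] (∀ x → eval fs x ≡ eval fs r + (x - r) * eval {d} gs x)
    factor-theorem (f ∷ []) r = [] , eq f r
      where
      eq : ∀ f r x → f + x * 1ℤ ≡ f + r * 1ℤ + (x - r) * 1ℤ
      eq = solve-∀
    factor-theorem (f ∷ fs@(_ ∷ _)) r with factor-theorem fs r
    ... | gs , gs≡ with add-multiple fs r gs
    ...   | hs , hs≡ = hs , λ x → trans (cong (λ F → f + x * F) (gs≡ x)) (trans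
                         (eq f r x (eval fs r) (eval gs x))
                         (cong (λ H → f + r * eval fs r + (x - r) * H)
                               (sym (trans (hs≡ x) (cong (_+ r * eval gs x) (gs≡ x))))))
      where
      eq : ∀ f r x F G → f + x * (F + (x - r) * G) ≡ f + r * F + (x - r) * (F + (x - r) * G + r * G)
      eq = solve-∀

    -- Dividing by one root at a time keeps the polynomial monic, and ends with the constant 1 and
    -- one root left over.
    too-many-roots : ∀ {d} (fs : Vec ℤ d) (root : Fin (suc d) → ℤ) →
                     (∀ {i j} → root i ≈ root j → i ≡ j) → ¬ (∀ i → eval fs (root i) ≈ 0ℤ)
    too-many-roots [] root inj roots = 1≉0 (roots Fin.zero)
    too-many-roots fs@(_ ∷ _) root inj roots with factor-theorem fs (root Fin.zero)
    ... | gs , gs≡ = too-many-roots gs (root ∘ Fin.suc) (Fin.suc-injective ∘ inj) roots′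
      where
      r = root Fin.zero
      roots′ : ∀ i → eval gs (root (Fin.suc i)) ≈ 0ℤ
      roots′ i = [ (λ x-r≈0 → contradiction (inj (-≈0⇒≈ x-r≈0)) λ ()) , id ]′ (zero-product (x - r) (eval gs x) (begin
          (x - r) * eval gs x             ≡⟨ ℤ.+-identityˡ _ ⟨
          0ℤ + (x - r) * eval gs x        ≈⟨ +-monoˡ ((x - r) * eval gs x) (roots Fin.zero) ⟨
          eval fs r + (x - r) * eval gs x ≡⟨ gs≡ x ⟨
          eval fs x                       ≈⟨ roots (Fin.suc i) ⟩
          0ℤ                              ∎))
        where x = root (Fin.suc i)

    eval-replicate : ∀ n x → eval (replicate n 0ℤ) x ≡ x ^ n
    eval-replicate zero    x = refl
    eval-replicate (suc n) x = trans (ℤ.+-identityˡ _) (cong (x *_) (eval-replicate n x))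

    IsSquare : ℤ → Set
    IsSquare x = ∃[ y ] (y * y ≈ x)

    -- Decidability is what allows `euler` to argue by contradiction.
    square? : ∀ x → Dec (IsSquare x)
    square? x = Dec.map′ (λ (n , _ , nn≈x) → + n , nn≈x)
                         (λ (y , yy≈x) → y %ℕ p , ℤ.n%ℕd<d y p , ≈-trans (≈-sym (*-mono (residue y) (residue y))) yy≈x)
                         (ℕ.anyUpTo? (λ n → + n * + n ≈? x) p)

    module Odd (m : ℕ) (p≡ : p ≡ suc (m ℕ.+ m)) where

      2≉0 : + 2 ≉ 0ℤ
      2≉0 2≈0 = 2≢1+2n m (trans (ℕ.≤-antisym (1<prime prime) (ℕ.∣⇒≤ (≈0⇒∣ 2≈0))) p≡)
        where
        2≢1+2n : ∀ n → 2 ≢ suc (n ℕ.+ n)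
        2≢1+2n (suc n) eq = ℕ.0≢1+n (trans (ℕ.suc-injective (ℕ.suc-injective eq)) (ℕ.+-suc n n))

      fermat-half : ∀ {x} → x ≉ 0ℤ → x ^ m * x ^ m ≈ 1ℤ
      fermat-half {x} x≉0 = *-cancelˡ x x≉0 (begin
        x * (x ^ m * x ^ m)  ≈⟨ *-monoʳ x (^-homo-* x m m) ⟨
        x ^ suc (m ℕ.+ m)    ≡⟨ cong (x ^_) p≡ ⟨
        x ^ p                ≈⟨ fermat x ⟩
        x                    ≡⟨ ℤ.*-identityʳ x ⟨
        x * 1ℤ               ∎)

      euler-± : ∀ {x} → x ≉ 0ℤ → x ^ m ≈ 1ℤ ⊎ x ^ m ≈ - 1ℤ
      euler-± {x} x≉0 = square≈1 (x ^ m) (fermat-half x≉0)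

      euler-square : ∀ {x y} → x ≉ 0ℤ → y * y ≈ x → x ^ m ≈ 1ℤ
      euler-square {x} {y} x≉0 yy≈x = begin
        x ^ m          ≈⟨ ^-congˡ m yy≈x ⟨
        (y * y) ^ m    ≈⟨ ^-distrib-* y y m ⟩
        y ^ m * y ^ m  ≈⟨ fermat-half (λ y≈0 → x≉0 (≈-trans (≈-sym yy≈x) (*-mono y≈0 y≈0))) ⟩
        1ℤ             ∎

      X^m-1 : ∃[ fs ] (∀ x → eval {m} fs x ≡ x ^ m - 1ℤ)
      X^m-1 = monic m refl
        where
        monic : ∀ n → n ≡ m → ∃[ fs ] (∀ x → eval {n} fs x ≡ x ^ n - 1ℤ)
        -- X^0 - 1 is not monic, but `m = 0` would mean `p = 1`.
        monic zero    refl = ⊥-elim (ℕ.<-irrefl (sym p≡) (1<prime prime))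
        monic (suc n) _    = (- 1ℤ ∷ replicate n 0ℤ) ,
          λ x → trans (cong (λ e → - 1ℤ + x * e) (eval-replicate n x)) (ℤ.+-comm (- 1ℤ) (x * x ^ n))

      -- Were x a nonsquare, X^m - 1 would have m + 1 distinct roots: x and the m squares f i * f i.
      euler-with : (f : Fin m → ℤ) → (∀ i → f i ≉ 0ℤ) → (∀ {i j} → f i ≈ f j → i ≡ j) →
                   (∀ i j → f i + f j ≉ 0ℤ) → ∀ {x} → x ^ m ≈ 1ℤ → ¬ ¬ IsSquare x
      euler-with f f≉0 f-injective f+f≉0 {x} x^m≈1 nonsquare =
        too-many-roots (proj₁ X^m-1) root root-injective roots
        where
        root : Fin (suc m) → ℤ
        root Fin.zero    = x
        root (Fin.suc i) = f i * f i

        root-injective : ∀ {i j} → root i ≈ root j → i ≡ j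
        root-injective {Fin.zero}  {Fin.zero}  _  = refl
        root-injective {Fin.zero}  {Fin.suc j} eq = contradiction (f j , ≈-sym eq) nonsquare
        root-injective {Fin.suc i} {Fin.zero}  eq = contradiction (f i , eq) nonsquare
        root-injective {Fin.suc i} {Fin.suc j} eq =
          [ (λ fi≈fj → cong Fin.suc (f-injective fi≈fj)) , (λ f+f≈0 → contradiction f+f≈0 (f+f≉0 i j)) ]′
            (square≈square (f i) (f j) eq)

        y^m≈1⇒root : ∀ y → y ^ m ≈ 1ℤ → eval (proj₁ X^m-1) y ≈ 0ℤ
        y^m≈1⇒root y y^m≈1 = begin
          eval (proj₁ X^m-1) y ≡⟨ proj₂ X^m-1 y ⟩
          y ^ m - 1ℤ           ≈⟨ +-monoˡ (- 1ℤ) y^m≈1 ⟩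
          0ℤ                   ∎

        roots : ∀ i → eval (proj₁ X^m-1) (root i) ≈ 0ℤ
        roots Fin.zero    = y^m≈1⇒root x x^m≈1
        roots (Fin.suc i) = y^m≈1⇒root (f i * f i) (euler-square {f i * f i} {f i} (*-nonzero (f≉0 i) (f≉0 i)) ≈-refl)

      euler : ∀ {x} → x ^ m ≈ 1ℤ → IsSquare x
      euler {x} x^m≈1 =
        Dec.decidable-stable (square? x) (euler-with f (λ i → nonzero (small i)) f-injective (λ i j → nonzero (small-sum i j)) {x} x^m≈1)
        where
        -- The numbers 1, ..., m contain one of each pair of opposite nonzero residues: two of them
        -- add up to at most 2m = p - 1.
        f : Fin m → ℤ
        f i = + suc (toℕ i)

        nonzero : ∀ {n} → suc n < p → + suc n ≉ 0ℤ
        nonzero n<p n≈0 = ℕ.>⇒∤ n<p (≈0⇒∣ n≈0)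

        small : ∀ (i : Fin m) → suc (toℕ i) < p
        small i = subst (suc (toℕ i) <_) (sym p≡) (s≤s (ℕ.≤-trans (Fin.toℕ<n i) (ℕ.m≤m+n m m)))

        small-sum : ∀ (i j : Fin m) → suc (toℕ i ℕ.+ suc (toℕ j)) < p
        small-sum i j = subst (suc (toℕ i ℕ.+ suc (toℕ j)) <_) (sym p≡) (s≤s (ℕ.+-mono-≤ (Fin.toℕ<n i) (Fin.toℕ<n j)))

        f-injective : ∀ {i j} → f i ≈ f j → i ≡ j
        f-injective {i} {j} fi≈fj = Fin.toℕ-injective (ℕ.suc-injective (≈⇒≡ (small i) (small j) fi≈fj))

      euler-nonsquare : ∀ {x} → x ≉ 0ℤ → ¬ IsSquare x → x ^ m ≈ - 1ℤ
      euler-nonsquare {x} x≉0 nonsquare =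
        [ (λ x^m≈1 → contradiction (euler {x} x^m≈1) nonsquare) , id ]′ (euler-± {x} x≉0)

  -- The ring of residues modulo p with a root z of z² - a z + 1 adjoined

  module Extension (p : ℕ) (a : ℤ) where
    open Modulo p

    infix  4 _≋_
    infixl 6 _⊕_
    infixl 7 _⊗_

    -- x +z y is the element x + y z of ℤ[z]/(z² - a z + 1).
    infix 5 _+z_
    record Element : Set where
      constructor _+z_
      field
        re im : ℤ

    open Element

    record _≋_ (x y : Element) : Set where
      constructor _,_
      field
        re≈ : re x ≈ re y
        im≈ : im x ≈ im y

    open _≋_ public

    _⊕_ _⊗_ : Element → Element → Element
    (x +z x′) ⊕ (y +z y′) = x + y +z x′ + y′
    (x +z x′) ⊗ (y +z y′) = x * y - x′ * y′ +z x * y′ + x′ * y + a * (x′ * y′)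

    ⊖_ : Element → Element
    ⊖ (x +z x′) = - x +z - x′

    ι : ℤ → Element
    ι x = x +z 0ℤ

    ≋-reflexive : ∀ {x y} → x ≡ y → x ≋ y
    ≋-reflexive refl = ≈-refl , ≈-refl

    ⊗-cong : ∀ {x y v w} → x ≋ y → v ≋ w → x ⊗ v ≋ y ⊗ w
    ⊗-cong (x≈ , x′≈) (v≈ , v′≈) =
      +-mono (*-mono x≈ v≈) (-‿mono (*-mono x′≈ v′≈)) ,
      +-mono (+-mono (*-mono x≈ v′≈) (*-mono x′≈ v≈)) (*-monoʳ a (*-mono x′≈ v′≈))

    ⊗-assoc : ∀ x y v → (x ⊗ y) ⊗ v ≡ x ⊗ (y ⊗ v)
    ⊗-assoc (x +z x′) (y +z y′) (v +z v′) = cong₂ _+z_ (re-eq a x x′ y y′ v v′) (im-eq a x x′ y y′ v v′)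
      where
      re-eq : ∀ a x x′ y y′ v v′ → (x * y - x′ * y′) * v - (x * y′ + x′ * y + a * (x′ * y′)) * v′ ≡
                                   x * (y * v - y′ * v′) - x′ * (y * v′ + y′ * v + a * (y′ * v′))
      re-eq = solve-∀
      im-eq : ∀ a x x′ y y′ v v′ →
        (x * y - x′ * y′) * v′ + (x * y′ + x′ * y + a * (x′ * y′)) * v + a * ((x * y′ + x′ * y + a * (x′ * y′)) * v′) ≡
        x * (y * v′ + y′ * v + a * (y′ * v′)) + x′ * (y * v - y′ * v′) + a * (x′ * (y * v′ + y′ * v + a * (y′ * v′)))
      im-eq = solve-∀

    ⊗-comm : ∀ x y → x ⊗ y ≡ y ⊗ x
    ⊗-comm (x +z x′) (y +z y′) = cong₂ _+z_ (re-eq x x′ y y′) (im-eq a x x′ y y′)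
      where
      re-eq : ∀ x x′ y y′ → x * y - x′ * y′ ≡ y * x - y′ * x′
      re-eq = solve-∀
      im-eq : ∀ a x x′ y y′ → x * y′ + x′ * y + a * (x′ * y′) ≡ y * x′ + y′ * x + a * (y′ * x′)
      im-eq = solve-∀

    ⊗-identityˡ : ∀ x → ι 1ℤ ⊗ x ≡ x
    ⊗-identityˡ (x +z x′) = cong₂ _+z_ (re-eq x x′) (im-eq a x x′)
      where
      re-eq : ∀ x x′ → 1ℤ * x - 0ℤ * x′ ≡ x
      re-eq = solve-∀
      im-eq : ∀ a x x′ → 1ℤ * x′ + 0ℤ * x + a * (0ℤ * x′) ≡ x′
      im-eq = solve-∀

    ⊗-distribˡ-⊕ : ∀ x y v → x ⊗ (y ⊕ v) ≡ x ⊗ y ⊕ x ⊗ v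
    ⊗-distribˡ-⊕ (x +z x′) (y +z y′) (v +z v′) = cong₂ _+z_ (re-eq x x′ y y′ v v′) (im-eq a x x′ y y′ v v′)
      where
      re-eq : ∀ x x′ y y′ v v′ → x * (y + v) - x′ * (y′ + v′) ≡ x * y - x′ * y′ + (x * v - x′ * v′)
      re-eq = solve-∀
      im-eq : ∀ a x x′ y y′ v v′ → x * (y′ + v′) + x′ * (y + v) + a * (x′ * (y′ + v′)) ≡
              x * y′ + x′ * y + a * (x′ * y′) + (x * v′ + x′ * v + a * (x′ * v′))
      im-eq = solve-∀

    ring : CommutativeRing 0ℓ 0ℓ
    ring = record
      { _≈_ = _≋_
      ; _+_ = _⊕_
      ; _*_ = _⊗_
      ; -_ = ⊖_
      ; 0# = ι 0ℤ
      ; 1# = ι 1ℤ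
      ; isCommutativeRing = record
        { isRing = record
          { +-isAbelianGroup = record
            { isGroup = record
              { isMonoid = record
                { isSemigroup = record
                  { isMagma = record
                    { isEquivalence = record
                      { refl = ≋-reflexive refl
                      ; sym = λ (r , i) → ≈-sym r , ≈-sym i
                      ; trans = λ (r , i) (r′ , i′) → ≈-trans r r′ , ≈-trans i i′
                      }
                    ; ∙-cong = λ (r , i) (r′ , i′) → +-mono r r′ , +-mono i i′
                    }
                  ; assoc = λ (x +z x′) (y +z y′) (v +z v′) → ≋-reflexive (cong₂ _+z_ (ℤ.+-assoc x y v) (ℤ.+-assoc x′ y′ v′))
                  }
                ; identity = (λ (x +z x′) → ≋-reflexive (cong₂ _+z_ (ℤ.+-identityˡ x) (ℤ.+-identityˡ x′)))
                           , (λ (x +z x′) → ≋-reflexive (cong₂ _+z_ (ℤ.+-identityʳ x) (ℤ.+-identityʳ x′)))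
                }
              ; inverse = (λ (x +z x′) → ≋-reflexive (cong₂ _+z_ (ℤ.+-inverseˡ x) (ℤ.+-inverseˡ x′)))
                        , (λ (x +z x′) → ≋-reflexive (cong₂ _+z_ (ℤ.+-inverseʳ x) (ℤ.+-inverseʳ x′)))
              ; ⁻¹-cong = λ (r , i) → -‿mono r , -‿mono i
              }
            ; comm = λ (x +z x′) (y +z y′) → ≋-reflexive (cong₂ _+z_ (ℤ.+-comm x y) (ℤ.+-comm x′ y′))
            }
          ; *-cong = ⊗-cong
          ; *-assoc = λ x y v → ≋-reflexive (⊗-assoc x y v)
          ; *-identity = (λ x → ≋-reflexive (⊗-identityˡ x))
                       , (λ x → ≋-reflexive (trans (⊗-comm x (ι 1ℤ)) (⊗-identityˡ x)))
          ; distrib = (λ x y v → ≋-reflexive (⊗-distribˡ-⊕ x y v))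
                    , (λ x y v → ≋-reflexive (trans (⊗-comm (y ⊕ v) x)
                        (trans (⊗-distribˡ-⊕ x y v) (cong₂ _⊕_ (⊗-comm x y) (⊗-comm x v)))))
          }
        ; *-comm = λ x y → ≋-reflexive (⊗-comm x y)
        }
      }

    module R = CommutativeRing ring
    open import Algebra.Properties.CommutativeSemiring.Exp R.commutativeSemiring public
      using () renaming (_^_ to _^ᴿ_; ^-distrib-* to ^ᴿ-distrib-⊗; ^-homo-* to ^ᴿ-homo-⊗)
    open import Algebra.Properties.Semiring.Mult R.semiring public
      using () renaming (_×_ to _⨯ᴿ_)

    p⨯ᴿ≋0 : ∀ x → p ⨯ᴿ x ≋ ι 0ℤ
    p⨯ᴿ≋0 x = R.trans (≋-reflexive (componentwise p x)) (p⨯≈0 (re x) , p⨯≈0 (im x))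
      where
      componentwise : ∀ n x → n ⨯ᴿ x ≡ (n ⨯ re x +z n ⨯ im x)
      componentwise zero    x = refl
      componentwise (suc n) x = cong (x ⊕_) (componentwise n x)

    ι-⊗ : ∀ x y y′ → ι x ⊗ (y +z y′) ≡ (x * y +z x * y′)
    ι-⊗ x y y′ = cong₂ _+z_ (re-eq x y y′) (im-eq a x y y′)
      where
      re-eq : ∀ x y y′ → x * y - 0ℤ * y′ ≡ x * y
      re-eq = solve-∀
      im-eq : ∀ a x y y′ → x * y′ + 0ℤ * y + a * (0ℤ * y′) ≡ x * y′
      im-eq = solve-∀

    ι-homo-* : ∀ x y → ι x ⊗ ι y ≡ ι (x * y)
    ι-homo-* x y = trans (ι-⊗ x y 0ℤ) (cong (x * y +z_) (ℤ.*-zeroʳ x))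

    ι-homo-^ : ∀ x n → ι x ^ᴿ n ≡ ι (x ^ n)
    ι-homo-^ x zero    = refl
    ι-homo-^ x (suc n) = trans (cong (ι x ⊗_) (ι-homo-^ x n)) (ι-homo-* x (x ^ n))

    ι-cong : ∀ {x y} → x ≈ y → ι x ≋ ι y
    ι-cong x≈y = x≈y , ≈-refl

    z : Element
    z = 0ℤ +z 1ℤ

    -- The constant part is -u_(n-1), written so as to make sense for `n = 0`.
    z^≡ : ∀ n → z ^ᴿ n ≡ (u (suc n) a - a * u n a +z u n a)
    z^≡ zero    = cong (_+z 0ℤ) (eq a)
      where
      eq : ∀ a → 1ℤ ≡ 1ℤ - a * 0ℤ
      eq = solve-∀
    z^≡ (suc n) = trans (cong (z ⊗_) (z^≡ n)) (cong₂ _+z_ (re-eq a (u n a) (u (suc n) a)) (im-eq a (u n a) (u (suc n) a)))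
      where
      re-eq : ∀ a v w → 0ℤ * (w - a * v) - 1ℤ * v ≡ a * w - v - a * w
      re-eq = solve-∀
      im-eq : ∀ a v w → 0ℤ * v + 1ℤ * (w - a * v) + a * (1ℤ * v) ≡ w
      im-eq = solve-∀

    -- The sum of an element and its conjugate, where `z` has the conjugate `a - z`.
    trace : Element → ℤ
    trace (x +z x′) = + 2 * x + a * x′

    trace-cong : ∀ {x y} → x ≋ y → trace x ≈ trace y
    trace-cong (r , i) = +-mono (*-monoʳ (+ 2) r) (*-monoʳ a i)

    trace-z^ : ∀ n → trace (z ^ᴿ n) ≡ c n a
    trace-z^ n = trans (cong trace (z^≡ n)) (trans (eq a (u n a) (u (suc n) a)) (sym (c≡2u-au n a)))
      where
      eq : ∀ a v w → + 2 * (w - a * v) + a * v ≡ + 2 * w - a * v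
      eq = solve-∀

  -- The value of C_n(a) at n = (p - 1)/2 or (p + 1)/2

  module Chebyshev {p m : ℕ} (prime : Prime p) (p≡ : p ≡ suc (m ℕ.+ m)) (a : ℤ) where
    open Modulo p
    open PrimeModulo prime
    open Odd m p≡
    open Extension p a
    open import Relation.Binary.Reasoning.Setoid R.setoid

    frobenius : ∀ x y → (x ⊕ y) ^ᴿ p ≋ x ^ᴿ p ⊕ y ^ᴿ p
    frobenius = Frobenius.^-distrib-+ R.commutativeSemiring prime p⨯ᴿ≋0

    ^ᴿp : ∀ x → x ^ᴿ p ≋ x ⊗ (x ⊗ x) ^ᴿ m
    ^ᴿp x = begin
      x ^ᴿ p                    ≡⟨ cong (x ^ᴿ_) p≡ ⟩
      x ⊗ x ^ᴿ (m ℕ.+ m)        ≈⟨ R.*-congˡ {x} (^ᴿ-homo-⊗ x m m) ⟩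
      x ⊗ (x ^ᴿ m ⊗ x ^ᴿ m)     ≈⟨ R.*-congˡ {x} (^ᴿ-distrib-⊗ x x m) ⟨
      x ⊗ (x ⊗ x) ^ᴿ m          ∎

    -- This is 2z - a, the difference between `z` and its conjugate.
    √δ : Element
    √δ = - a +z + 2

    √δ⊗√δ : √δ ⊗ √δ ≡ ι (a * a - + 4)
    √δ⊗√δ = cong₂ _+z_ (re-eq a) (im-eq a)
      where
      re-eq : ∀ a → - a * - a - + 2 * + 2 ≡ a * a - + 4
      re-eq = solve-∀
      im-eq : ∀ a → - a * + 2 + + 2 * - a + a * (+ 2 * + 2) ≡ 0ℤ
      im-eq = solve-∀

    z+z : z ⊕ z ≡ ι a ⊕ √δ
    z+z = cong (_+z + 2) (sym (ℤ.+-inverseʳ a))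

    -- Since 2z = a + √δ, Frobenius can be read off from its effect on the right: it fixes `a` and
    -- multiplies `√δ` by δ^m. Expanding (z + z)^p additively avoids any power of 2.
    2z^p : ∀ {e} → (a * a - + 4) ^ m ≈ e → z ^ᴿ p ⊕ z ^ᴿ p ≋ ι a ⊕ ι e ⊗ √δ
    2z^p {e} δ^m≈e = begin
      z ^ᴿ p ⊕ z ^ᴿ p                     ≈⟨ frobenius z z ⟨
      (z ⊕ z) ^ᴿ p                        ≡⟨ cong (_^ᴿ p) z+z ⟩
      (ι a ⊕ √δ) ^ᴿ p                     ≈⟨ frobenius (ι a) √δ ⟩
      ι a ^ᴿ p ⊕ √δ ^ᴿ p                  ≡⟨ cong (_⊕ √δ ^ᴿ p) (ι-homo-^ a p) ⟩
      ι (a ^ p) ⊕ √δ ^ᴿ p                 ≈⟨ R.+-cong (ι-cong (fermat a)) (^ᴿp √δ) ⟩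
      ι a ⊕ √δ ⊗ (√δ ⊗ √δ) ^ᴿ m           ≡⟨ cong (λ x → ι a ⊕ √δ ⊗ x ^ᴿ m) √δ⊗√δ ⟩
      ι a ⊕ √δ ⊗ ι (a * a - + 4) ^ᴿ m     ≡⟨ cong (λ x → ι a ⊕ √δ ⊗ x) (ι-homo-^ (a * a - + 4) m) ⟩
      ι a ⊕ √δ ⊗ ι ((a * a - + 4) ^ m)    ≈⟨ R.+-congˡ {ι a} (R.*-congˡ {√δ} (ι-cong δ^m≈e)) ⟩
      ι a ⊕ √δ ⊗ ι e                      ≡⟨ cong (ι a ⊕_) (⊗-comm √δ (ι e)) ⟩
      ι a ⊕ ι e ⊗ √δ                      ∎

    halve : ∀ {x y} → x ⊕ x ≋ y ⊕ y → x ≋ y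
    halve {x +z x′} {y +z y′} (r , i) =
      *-cancelˡ (+ 2) 2≉0 (≈-trans (≈-reflexive (double x)) (≈-trans r (≈-reflexive (sym (double y))))) ,
      *-cancelˡ (+ 2) 2≉0 (≈-trans (≈-reflexive (double x′)) (≈-trans i (≈-reflexive (sym (double y′)))))
      where
      double : ∀ x → + 2 * x ≡ x + x
      double = solve-∀

    z̄ : Element
    z̄ = a +z - 1ℤ

    z⊗z̄ : z ⊗ z̄ ≡ ι 1ℤ
    z⊗z̄ = cong₂ _+z_ (re-eq a) (im-eq a)
      where
      re-eq : ∀ a → 0ℤ * a - 1ℤ * - 1ℤ ≡ 1ℤ
      re-eq = solve-∀
      im-eq : ∀ a → 0ℤ * - 1ℤ + 1ℤ * a + a * (1ℤ * - 1ℤ) ≡ 0ℤ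
      im-eq = solve-∀

    z^p≋z : (a * a - + 4) ^ m ≈ 1ℤ → z ^ᴿ p ≋ z
    z^p≋z δ^m≈1 = halve (begin
      z ^ᴿ p ⊕ z ^ᴿ p    ≈⟨ 2z^p δ^m≈1 ⟩
      ι a ⊕ ι 1ℤ ⊗ √δ    ≡⟨ cong (ι a ⊕_) (⊗-identityˡ √δ) ⟩
      ι a ⊕ √δ           ≡⟨ z+z ⟨
      z ⊕ z              ∎)

    -- Frobenius changes the sign of `√δ`, so it acts on `z` as conjugation, that is, as inversion.
    z^p≋z̄ : (a * a - + 4) ^ m ≈ - 1ℤ → z ^ᴿ p ≋ z̄
    z^p≋z̄ δ^m≈-1 = halve (begin
      z ^ᴿ p ⊕ z ^ᴿ p       ≈⟨ 2z^p δ^m≈-1 ⟩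
      ι a ⊕ ι (- 1ℤ) ⊗ √δ   ≡⟨ cong (ι a ⊕_) (trans (ι-⊗ (- 1ℤ) (- a) (+ 2)) (cong (_+z - + 2) (neg-neg a))) ⟩
      ι a ⊕ (a +z - + 2)    ≡⟨⟩
      z̄ ⊕ z̄                 ∎)
      where
      neg-neg : ∀ a → - 1ℤ * - a ≡ a
      neg-neg = solve-∀

    1+z : Element
    1+z = z ⊕ ι 1ℤ

    1+z-squared : 1+z ⊗ 1+z ≡ z ⊗ ι (a + + 2)
    1+z-squared = cong₂ _+z_ (re-eq a) (im-eq a)
      where
      re-eq : ∀ a → (0ℤ + 1ℤ) * (0ℤ + 1ℤ) - (1ℤ + 0ℤ) * (1ℤ + 0ℤ) ≡ 0ℤ * (a + + 2) - 1ℤ * 0ℤ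
      re-eq = solve-∀
      im-eq : ∀ a → (0ℤ + 1ℤ) * (1ℤ + 0ℤ) + (1ℤ + 0ℤ) * (0ℤ + 1ℤ) + a * ((1ℤ + 0ℤ) * (1ℤ + 0ℤ)) ≡
                    0ℤ * 0ℤ + 1ℤ * (a + + 2) + a * (1ℤ * 0ℤ)
      im-eq = solve-∀

    1+z̄ : 1+z ⊗ z̄ ≡ z̄ ⊕ ι 1ℤ
    1+z̄ = cong₂ _+z_ (re-eq a) (im-eq a)
      where
      re-eq : ∀ a → (0ℤ + 1ℤ) * a - (1ℤ + 0ℤ) * - 1ℤ ≡ a + 1ℤ
      re-eq = solve-∀
      im-eq : ∀ a → (0ℤ + 1ℤ) * - 1ℤ + (1ℤ + 0ℤ) * a + a * ((1ℤ + 0ℤ) * - 1ℤ) ≡ - 1ℤ + 0ℤ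
      im-eq = solve-∀

    norm-1+z : (z̄ ⊕ ι 1ℤ) ⊗ 1+z ≡ ι (a + + 2)
    norm-1+z = cong₂ _+z_ (re-eq a) (im-eq a)
      where
      re-eq : ∀ a → (a + 1ℤ) * (0ℤ + 1ℤ) - (- 1ℤ + 0ℤ) * (1ℤ + 0ℤ) ≡ a + + 2
      re-eq = solve-∀
      im-eq : ∀ a → (a + 1ℤ) * (1ℤ + 0ℤ) + (- 1ℤ + 0ℤ) * (0ℤ + 1ℤ) + a * ((- 1ℤ + 0ℤ) * (1ℤ + 0ℤ)) ≡ 0ℤ
      im-eq = solve-∀

    ι-cancelˡ : ∀ {t} → t ≉ 0ℤ → ∀ {x y} → ι t ⊗ x ≋ ι t ⊗ y → x ≋ y
    ι-cancelˡ {t} t≉0 {x +z x′} {y +z y′} tx≋ty =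
      *-cancelˡ t t≉0 (re≈ scaled) , *-cancelˡ t t≉0 (im≈ scaled)
      where
      scaled : (t * x +z t * x′) ≋ (t * y +z t * y′)
      scaled = begin
        t * x +z t * x′    ≡⟨ ι-⊗ t x x′ ⟨
        ι t ⊗ (x +z x′)    ≈⟨ tx≋ty ⟩
        ι t ⊗ (y +z y′)    ≡⟨ ι-⊗ t y y′ ⟩
        t * y +z t * y′    ∎

    module _ (a+2≉0 : a + + 2 ≉ 0ℤ) where

      -- The ring has zero divisors when a² - 4 is a square, so cancellation needs an argument:
      -- multiplying by the conjugate of 1 + z leaves its norm `a + 2`, a nonzero scalar.
      1+z-cancelˡ : ∀ {x y} → 1+z ⊗ x ≋ 1+z ⊗ y → x ≋ y
      1+z-cancelˡ {x} {y} eq = ι-cancelˡ a+2≉0 (begin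
        ι (a + + 2) ⊗ x             ≡⟨ cong (_⊗ x) norm-1+z ⟨
        (z̄ ⊕ ι 1ℤ) ⊗ 1+z ⊗ x        ≡⟨ ⊗-assoc (z̄ ⊕ ι 1ℤ) 1+z x ⟩
        (z̄ ⊕ ι 1ℤ) ⊗ (1+z ⊗ x)      ≈⟨ R.*-congˡ {z̄ ⊕ ι 1ℤ} eq ⟩
        (z̄ ⊕ ι 1ℤ) ⊗ (1+z ⊗ y)      ≡⟨ ⊗-assoc (z̄ ⊕ ι 1ℤ) 1+z y ⟨
        (z̄ ⊕ ι 1ℤ) ⊗ 1+z ⊗ y        ≡⟨ cong (_⊗ y) norm-1+z ⟩
        ι (a + + 2) ⊗ y             ∎)

      s : ℤ
      s = (a + + 2) ^ m

      -- Compares the p-th power of 1 + z given by Frobenius with 1 + z times the m-th power of (1 + z)² = z (a + 2).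
      1+z^p : 1+z ⊗ (z ^ᴿ m ⊗ ι s) ≋ z ^ᴿ p ⊕ ι 1ℤ
      1+z^p = begin
        1+z ⊗ (z ^ᴿ m ⊗ ι s)                  ≡⟨ cong (λ x → 1+z ⊗ (z ^ᴿ m ⊗ x)) (ι-homo-^ (a + + 2) m) ⟨
        1+z ⊗ (z ^ᴿ m ⊗ ι (a + + 2) ^ᴿ m)     ≈⟨ R.*-congˡ {1+z} (^ᴿ-distrib-⊗ z (ι (a + + 2)) m) ⟨
        1+z ⊗ (z ⊗ ι (a + + 2)) ^ᴿ m          ≡⟨ cong (λ x → 1+z ⊗ x ^ᴿ m) 1+z-squared ⟨
        1+z ⊗ (1+z ⊗ 1+z) ^ᴿ m                ≈⟨ ^ᴿp 1+z ⟨
        1+z ^ᴿ p                              ≈⟨ frobenius z (ι 1ℤ) ⟩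
        z ^ᴿ p ⊕ ι 1ℤ ^ᴿ p                    ≡⟨ cong (z ^ᴿ p ⊕_) (ι-homo-^ 1ℤ p) ⟩
        z ^ᴿ p ⊕ ι (1ℤ ^ p)                   ≈⟨ R.+-congˡ {z ^ᴿ p} (ι-cong (1^≈1 p)) ⟩
        z ^ᴿ p ⊕ ι 1ℤ                         ∎

      -- By `fermat-half` the scalar `s` is its own inverse, so z^n equals `s`, and a scalar has
      -- twice itself as trace.
      z^n≋s : ∀ n → z ^ᴿ n ⊗ ι s ≋ ι 1ℤ → c n a ≈ + 2 * s
      z^n≋s n eq = ≈-trans (≈-reflexive (sym (trace-z^ n))) (≈-trans (trace-cong z^n≋ιs) (≈-reflexive (trace-ι a s)))
        where
        trace-ι : ∀ a s → + 2 * s + a * 0ℤ ≡ + 2 * s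
        trace-ι = solve-∀
        z^n≋ιs : z ^ᴿ n ≋ ι s
        z^n≋ιs = begin
          z ^ᴿ n                  ≈⟨ R.*-identityʳ (z ^ᴿ n) ⟨
          z ^ᴿ n ⊗ ι 1ℤ           ≈⟨ R.*-congˡ {z ^ᴿ n} (ι-cong (fermat-half a+2≉0)) ⟨
          z ^ᴿ n ⊗ ι (s * s)      ≡⟨ cong (z ^ᴿ n ⊗_) (ι-homo-* s s) ⟨
          z ^ᴿ n ⊗ (ι s ⊗ ι s)    ≡⟨ ⊗-assoc (z ^ᴿ n) (ι s) (ι s) ⟨
          z ^ᴿ n ⊗ ι s ⊗ ι s      ≈⟨ R.*-congʳ {ι s} eq ⟩
          ι 1ℤ ⊗ ι s              ≡⟨ ⊗-identityˡ (ι s) ⟩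
          ι s                     ∎

      c-split : (a * a - + 4) ^ m ≈ 1ℤ → c m a ≈ + 2 * s
      c-split δ^m≈1 = z^n≋s m (1+z-cancelˡ {z ^ᴿ m ⊗ ι s} {ι 1ℤ} (begin
        1+z ⊗ (z ^ᴿ m ⊗ ι s)   ≈⟨ 1+z^p ⟩
        z ^ᴿ p ⊕ ι 1ℤ          ≈⟨ R.+-congʳ {ι 1ℤ} (z^p≋z δ^m≈1) ⟩
        1+z                    ≈⟨ R.*-identityʳ 1+z ⟨
        1+z ⊗ ι 1ℤ             ∎))

      -- Frobenius inverts `z` here, so cancelling 1 + z leaves z^m s = 1/z instead of 1. One more
      -- factor `z` is needed, which moves the index from (p - 1)/2 to (p + 1)/2.
      c-inert : (a * a - + 4) ^ m ≈ - 1ℤ → c (suc m) a ≈ + 2 * s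
      c-inert δ^m≈-1 = z^n≋s (suc m) (begin
        z ⊗ z ^ᴿ m ⊗ ι s       ≡⟨ ⊗-assoc z (z ^ᴿ m) (ι s) ⟩
        z ⊗ (z ^ᴿ m ⊗ ι s)     ≈⟨ R.*-congˡ {z} (1+z-cancelˡ {z ^ᴿ m ⊗ ι s} {z̄} (begin
          1+z ⊗ (z ^ᴿ m ⊗ ι s)   ≈⟨ 1+z^p ⟩
          z ^ᴿ p ⊕ ι 1ℤ          ≈⟨ R.+-congʳ {ι 1ℤ} (z^p≋z̄ δ^m≈-1) ⟩
          z̄ ⊕ ι 1ℤ               ≡⟨ 1+z̄ ⟨
          1+z ⊗ z̄                ∎)) ⟩
        z ⊗ z̄                  ≡⟨ z⊗z̄ ⟩
        ι 1ℤ                   ∎)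

  -- Extraction of 2^k-th roots and the power of two in p̂

  module ChebyshevModulo (p : ℕ) where
    open Modulo p

    u-cong : ∀ n {a b} → a ≈ b → u n a ≈ u n b
    u-cong zero          a≈b = ≈-refl
    u-cong (suc zero)    a≈b = ≈-refl
    u-cong (suc (suc n)) a≈b = +-mono (*-mono a≈b (u-cong (suc n) a≈b)) (-‿mono (u-cong n a≈b))

    c-cong : ∀ n {a b} → a ≈ b → c n a ≈ c n b
    c-cong zero    a≈b = ≈-refl
    c-cong (suc n) a≈b = +-mono (u-cong (suc (suc n)) a≈b) (-‿mono (u-cong n a≈b))

  -- With p = 2m + 1 this says h = (p - (d|p))/2, the Legendre symbol being expressed by d^m as in
  -- Euler's criterion.
  HasHat : (p m : ℕ) → ℤ → ℕ → Set
  HasHat p m d h = (d ^ m ≈ 1ℤ × h ≡ m) ⊎ (d ^ m ≈ - 1ℤ × h ≡ suc m)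
    where open Modulo p

  module Descent {p m h : ℕ} (prime : Prime p) (p≡ : p ≡ suc (m ℕ.+ m)) (q : ℤ)
    (δ≉0 : Modulo._≉_ p (q * q - + 4) 0ℤ) (hat : HasHat p m (q * q - + 4) h)
    where

    open Modulo p
    open PrimeModulo prime
    open Odd m p≡
    open ChebyshevModulo p
    open import Relation.Binary.Reasoning.Setoid (CommutativeRing.setoid ℤ/)

    -- Lets one argument cover both signs: `q` and `- q` have the same discriminant and hence the
    -- same `h`.
    data IsConjugate : ℤ → Set where
      pos : IsConjugate q
      neg : IsConjugate (- q)

    opposite : ∀ {x} → IsConjugate x → IsConjugate (- x)
    opposite pos = neg
    opposite neg = subst IsConjugate (sym (ℤ.neg-involutive q)) pos

    conjugate-δ : ∀ {x} → IsConjugate x → x * x - + 4 ≡ q * q - + 4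
    conjugate-δ pos = refl
    conjugate-δ neg = eq q
      where
      eq : ∀ q → - q * - q - + 4 ≡ q * q - + 4
      eq = solve-∀

    module _ (n : ℕ) (a : ℤ) {x : ℤ} (conj : IsConjugate x) (cₙ≈x : c n a ≈ x) where

      -- Shows that `h` also fits `a`: the two discriminants differ by the square of `u n a`, which
      -- is nonzero because q² - 4 is, so their m-th powers agree.
      δ-transfer : u n a * u n a * (a * a - + 4) ≈ q * q - + 4
      δ-transfer = begin
        u n a * u n a * (a * a - + 4)   ≡⟨ c²-4 n a ⟨
        c n a * c n a - + 4             ≈⟨ +-monoˡ (- + 4) (*-mono cₙ≈x cₙ≈x) ⟩
        x * x - + 4                     ≡⟨ conjugate-δ conj ⟩
        q * q - + 4                     ∎

      u≉0 : u n a ≉ 0ℤ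
      u≉0 u≈0 = δ≉0 (≈-trans (≈-sym δ-transfer) (≈-trans (*-monoˡ (a * a - + 4) (*-monoˡ (u n a) u≈0))
                  (≈-reflexive (zero-left (u n a) (a * a - + 4)))))
        where
        zero-left : ∀ v w → 0ℤ * v * w ≡ 0ℤ
        zero-left = solve-∀

      a+2≉0 : a + + 2 ≉ 0ℤ
      a+2≉0 a+2≈0 = δ≉0 (begin
        q * q - + 4                                ≈⟨ δ-transfer ⟨
        u n a * u n a * (a * a - + 4)              ≡⟨ factor (u n a) a ⟩
        (a + + 2) * (u n a * u n a * (a - + 2))    ≈⟨ *-monoˡ (u n a * u n a * (a - + 2)) a+2≈0 ⟩
        0ℤ * (u n a * u n a * (a - + 2))           ≡⟨ ℤ.*-zeroˡ (u n a * u n a * (a - + 2)) ⟩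
        0ℤ                                         ∎)
        where
        factor : ∀ v a → v * v * (a * a - + 4) ≡ (a + + 2) * (v * v * (a - + 2))
        factor = solve-∀

      δ^m-transfer : (a * a - + 4) ^ m ≈ (q * q - + 4) ^ m
      δ^m-transfer = begin
        (a * a - + 4) ^ m                          ≡⟨ ℤ.*-identityˡ ((a * a - + 4) ^ m) ⟨
        1ℤ * (a * a - + 4) ^ m                     ≈⟨ *-monoˡ ((a * a - + 4) ^ m) (euler-square {u n a * u n a} {u n a} (*-nonzero u≉0 u≉0) ≈-refl) ⟨
        (u n a * u n a) ^ m * (a * a - + 4) ^ m    ≈⟨ ^-distrib-* (u n a * u n a) (a * a - + 4) m ⟨
        (u n a * u n a * (a * a - + 4)) ^ m        ≈⟨ ^-congˡ m δ-transfer ⟩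
        (q * q - + 4) ^ m                          ∎

      cₕ≈ : c h a ≈ + 2 * (a + + 2) ^ m
      cₕ≈ = [ (λ (δ^m≈1 , h≡m) → subst (λ h → c h a ≈ + 2 * (a + + 2) ^ m) (sym h≡m)
                  (Chebyshev.c-split {m = m} prime p≡ a a+2≉0 (≈-trans δ^m-transfer δ^m≈1)))
            , (λ (δ^m≈-1 , h≡1+m) → subst (λ h → c h a ≈ + 2 * (a + + 2) ^ m) (sym h≡1+m)
                  (Chebyshev.c-inert {m = m} prime p≡ a a+2≉0 (≈-trans δ^m-transfer δ^m≈-1)))
            ]′ hat

      cₕ≈±2 : (IsSquare (a + + 2)) ⊎ (c h a ≈ - + 2)
      cₕ≈±2 = Sum.map (euler {a + + 2})
                      (λ s≈-1 → ≈-trans cₕ≈ (*-monoʳ (+ 2) s≈-1))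
                      (euler-± a+2≉0)

      cₕ≈2⇒square : c h a ≈ + 2 → IsSquare (a + + 2)
      cₕ≈2⇒square cₕ≈2 = euler {a + + 2} (*-cancelˡ (+ 2) {(a + + 2) ^ m} {1ℤ} 2≉0 (≈-trans (≈-sym cₕ≈) cₕ≈2))

      c₂ₕ≈2 : c (h ℕ.+ h) a ≈ + 2
      c₂ₕ≈2 = begin
        c (h ℕ.+ h) a                       ≡⟨ c-double h a ⟩
        c h a * c h a - + 2                 ≈⟨ +-monoˡ (- + 2) (*-mono cₕ≈ cₕ≈) ⟩
        (+ 2 * s) * (+ 2 * s) - + 2         ≡⟨ regroup s ⟩
        + 4 * (s * s) - + 2                 ≈⟨ +-monoˡ (- + 2) (*-monoʳ (+ 4) (fermat-half a+2≉0)) ⟩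
        + 2                                 ∎
        where
        s = (a + + 2) ^ m
        regroup : ∀ s → (+ 2 * s) * (+ 2 * s) - + 2 ≡ + 4 * (s * s) - + 2
        regroup = solve-∀

    Root : ℕ → ℤ → Set
    Root k x = ∃[ a ] c (2 ℕ.^ k) a ≈ x

    c-2^suc : ∀ k a → c (2 ℕ.^ suc k) a ≡ c (2 ℕ.^ k) (c 2 a)
    c-2^suc k a = trans (cong (λ i → c i a) (ℕ.*-comm 2 (2 ℕ.^ k))) (c-∘ (2 ℕ.^ k) 2 a)

    Root-pred : ∀ k {x} → Root (suc k) x → Root k x
    Root-pred k (a , root) = c 2 a , ≈-trans (≈-reflexive (sym (c-2^suc k a))) root

    c≈root : ∀ k l a {x} → c (2 ℕ.^ k) a ≈ x → c l x ≈ c (l ℕ.* 2 ℕ.^ k) a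
    c≈root k l a {x} root = ≈-trans (c-cong l (≈-sym root)) (≈-reflexive (sym (c-∘ l (2 ℕ.^ k) a)))

    -- If b² = a + 2, then C_2(b) = b² - 2 = a: `b` is the trace of a square root of an element of
    -- trace `a`.
    square⇒Root-suc : ∀ k a {x} → c (2 ℕ.^ k) a ≈ x → IsSquare (a + + 2) → Root (suc k) x
    square⇒Root-suc k a {x} root (b , bb≈a+2) = b , (begin
      c (2 ℕ.^ suc k) b       ≡⟨ c-2^suc k b ⟩
      c (2 ℕ.^ k) (c 2 b)     ≈⟨ c-cong (2 ℕ.^ k) c₂b≈a ⟩
      c (2 ℕ.^ k) a           ≈⟨ root ⟩
      x                       ∎)
      where
      cancel : ∀ a → a + + 2 - + 2 ≡ a
      cancel = solve-∀
      c₂b≈a : c 2 b ≈ a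
      c₂b≈a = begin
        c 2 b             ≡⟨ c₂ b ⟩
        b * b - + 2       ≈⟨ +-monoˡ (- + 2) bb≈a+2 ⟩
        a + + 2 - + 2     ≡⟨ cancel a ⟩
        a                 ∎

    module _ {x : ℤ} (conj : IsConjugate x) (k l : ℕ) where

      -- If x is the trace of y = w^(2^k), then y^l = w^(2h) = 1.
      c≈2 : h ℕ.+ h ≡ l ℕ.* 2 ℕ.^ k → Root k x → c l x ≈ + 2
      c≈2 2h≡ (a , root) = begin
        c l x                     ≈⟨ c≈root k l a root ⟩
        c (l ℕ.* 2 ℕ.^ k) a       ≡⟨ cong (λ i → c i a) 2h≡ ⟨
        c (h ℕ.+ h) a             ≈⟨ c₂ₕ≈2 (2 ℕ.^ k) a conj root ⟩
        + 2                       ∎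

      -- Here y^l = w^h, so the value 1 makes w a square and y a 2^(k+1)-th power.
      c≈2⇒Root-suc : h ≡ l ℕ.* 2 ℕ.^ k → Root k x → c l x ≈ + 2 → Root (suc k) x
      c≈2⇒Root-suc h≡ (a , root) cₗ≈2 = square⇒Root-suc k a root (cₕ≈2⇒square (2 ℕ.^ k) a conj root (begin
        c h a                     ≡⟨ cong (λ i → c i a) h≡ ⟩
        c (l ℕ.* 2 ℕ.^ k) a       ≈⟨ c≈root k l a root ⟨
        c l x                     ≈⟨ cₗ≈2 ⟩
        + 2                       ∎))

      -- Again y^l = w^h is 1 or -1, and 1 would allow one more square root.
      c≈-2 : h ≡ l ℕ.* 2 ℕ.^ k → Root k x → ¬ Root (suc k) x → c l x ≈ - + 2
      c≈-2 h≡ (a , root) ¬root = [ (λ sq → contradiction (square⇒Root-suc k a root sq) ¬root)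
        , (λ cₕ≈-2 → begin
            c l x                     ≈⟨ c≈root k l a root ⟩
            c (l ℕ.* 2 ℕ.^ k) a       ≡⟨ cong (λ i → c i a) h≡ ⟨
            c h a                     ≈⟨ cₕ≈-2 ⟩
            - + 2                     ∎)
        ]′ (cₕ≈±2 (2 ℕ.^ k) a conj root)

    2≉-2 : + 2 ≉ - + 2
    2≉-2 2≈-2 = *-nonzero {+ 2} {+ 2} 2≉0 2≉0 (≈⇒-≈0 2≈-2)

    c-odd-neg : ∀ i x y → c (suc (i ℕ.+ i)) x ≈ y → c (suc (i ℕ.+ i)) (- x) ≈ - y
    c-odd-neg i x y eq = ≈-trans (≈-reflexive (proj₂ (c-neg i x))) (-‿mono eq)

    Both : ℕ → Set
    Both k = Root k q × Root k (- q)

    -- Inductively h = l 2^k. Roots of level k + 1 for both signs give C_l(q) = C_l(-q) = 2; an odd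
    -- `l` would make these values opposite, and 2 and -2 differ modulo an odd prime.
    Both⇒∣ : ∀ k → Both k → 2 ℕ.^ k ∣ h
    Both⇒∣ zero    _ = ℕ.1∣ h
    Both⇒∣ (suc k) (root₊ , root₋) with Both⇒∣ k (Root-pred k root₊ , Root-pred k root₋)
    ... | divides l h≡ with parity l
    ...   | inj₁ (i , refl) = divides i (half≡double {k = k} i h≡)
    ...   | inj₂ (i , refl) = contradiction
      (≈-trans (≈-sym (c≈2 neg (suc k) l (double≡ {k = k} l h≡) root₋))
               (c-odd-neg i q (+ 2) (c≈2 pos (suc k) l (double≡ {k = k} l h≡) root₊)))
      2≉-2

    Both⇒Root : ∀ k {x} → IsConjugate x → Both k → Root k x
    Both⇒Root k pos = proj₁
    Both⇒Root k neg = proj₂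

    -- The root of level k + 1 gives C_l(x) = 2. For even `l` also C_l(-x) = 2, and the root of -x
    -- of level k could be extended.
    one-sided : ∀ {x} → IsConjugate x → ∀ k → Root (suc k) x → ¬ Root (suc k) (- x) → Both k →
                ∃[ i ] (h ≡ suc (i ℕ.+ i) ℕ.* 2 ℕ.^ k × c (suc (i ℕ.+ i)) x ≈ + 2)
    one-sided {x} conj k root ¬root both with Both⇒∣ k both
    ... | divides l h≡ with parity l
    ...   | inj₂ (i , refl) = i , h≡ , c≈2 conj (suc k) l (double≡ {k = k} l h≡) root
    ...   | inj₁ (i , refl) = contradiction
      (c≈2⇒Root-suc (opposite conj) k l h≡ (Both⇒Root k (opposite conj) both)
        (≈-trans (≈-reflexive (proj₁ (c-neg i x))) (c≈2 conj (suc k) l (double≡ {k = k} l h≡) root)))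
      ¬root

    -- Both signs give the value -2, which excludes odd `l`. For l = 2i it remains to use C_i² =
    -- C_(2i) + 2.
    neither : ∀ k → Both k → ¬ Root (suc k) q → ¬ Root (suc k) (- q) →
              ∃[ i ] (h ≡ i ℕ.* 2 ℕ.^ suc k × c i q ≈ 0ℤ)
    neither k both@(root₊ , root₋) ¬root₊ ¬root₋ with Both⇒∣ k both
    ... | divides l h≡ with parity l
    ...   | inj₂ (i , refl) = contradiction
      (≈-trans (≈-sym (c-odd-neg i q (- + 2) (c≈-2 pos k l h≡ root₊ ¬root₊))) (c≈-2 neg k l h≡ root₋ ¬root₋))
      2≉-2
    ...   | inj₁ (i , refl) = i , half≡double {k = k} i h≡ , Sum.reduce (zero-product (c i q) (c i q) (begin
      c i q * c i q                     ≡⟨ shift (c i q * c i q) ⟩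
      c i q * c i q - + 2 + + 2         ≡⟨ cong (_+ + 2) (c-double i q) ⟨
      c (i ℕ.+ i) q + + 2               ≈⟨ +-monoˡ (+ 2) (c≈-2 pos k l h≡ root₊ ¬root₊) ⟩
      0ℤ                                ∎))
      where
      shift : ∀ x → x ≡ x - + 2 + + 2
      shift = solve-∀

    q±2≉0 : q - + 2 ≉ 0ℤ × q + + 2 ≉ 0ℤ
    q±2≉0 = (λ q-2≈0 → δ≉0 (≈-trans (≈-reflexive (factor₁ q)) (≈-trans (*-monoˡ (q + + 2) q-2≈0) (≈-reflexive (ℤ.*-zeroˡ (q + + 2))))))
          , (λ q+2≈0 → δ≉0 (≈-trans (≈-reflexive (factor₂ q)) (≈-trans (*-monoˡ (q - + 2) q+2≈0) (≈-reflexive (ℤ.*-zeroˡ (q - + 2))))))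
      where
      factor₁ : ∀ q → q * q - + 4 ≡ (q - + 2) * (q + + 2)
      factor₁ = solve-∀
      factor₂ : ∀ q → q * q - + 4 ≡ (q + + 2) * (q - + 2)
      factor₂ = solve-∀

    square-factor : ∀ x y → x ≉ 0ℤ → x * (y * y) ≈ 0ℤ → y ≈ 0ℤ
    square-factor x y x≉0 xyy≈0 =
      [ (λ x≈0 → contradiction x≈0 x≉0) , (λ yy≈0 → Sum.reduce (zero-product y y yy≈0)) ]′ (zero-product x (y * y) xyy≈0)

    c≈2⇒w≈0 : ∀ i → c (suc (i ℕ.+ i)) q ≈ + 2 → u (suc i) q + u i q ≈ 0ℤ
    c≈2⇒w≈0 i c≈2 = square-factor (q - + 2) (u (suc i) q + u i q) (proj₁ q±2≉0)
      (≈-trans (≈-reflexive (sym (c-odd-2 i q))) (≈⇒-≈0 c≈2))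

    c≈-2⇒v≈0 : ∀ i → c (suc (i ℕ.+ i)) q ≈ - + 2 → u (suc i) q - u i q ≈ 0ℤ
    c≈-2⇒v≈0 i c≈-2 = square-factor (q + + 2) (u (suc i) q - u i q) (proj₂ q±2≉0)
      (≈-trans (≈-reflexive (sym (c-odd+2 i q))) (+-monoˡ (+ 2) c≈-2))

  -- Reduction of rational numbers modulo p

  module Reduction {p : ℕ} (prime : Prime p) where
    open Modulo p
    open PrimeModulo prime
    open import Relation.Binary.Reasoning.Setoid (CommutativeRing.setoid ℤ/)
    private instance _ = prime⇒nonZero prime

    infix 4 _↦_

    record _↦_ (q : ℚ) (r : ℤ) : Set where
      constructor reduces
      field
        denominator≉0 : ↧ q ≉ 0ℤ
        numerator≈    : ↥ q ≈ r * ↧ q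

    open _↦_

    not-both : ∀ q → ↥ q ≈ 0ℤ → ↧ q ≉ 0ℤ
    not-both (mkℚ n d-1 coprime) n≈0 d≈0 = ℕ.<⇒≢ (1<prime prime) (sym (Coprime.recompute coprime (≈0⇒∣ n≈0 , ≈0⇒∣ d≈0)))

    -- Operations on ℚ cancel common factors, so the denominator of a result is known only through
    -- cross-multiplication with the uncancelled fraction `x`. If `p` divided it, `p` would divide
    -- the numerator as well, against lowest terms, or the denominator of `x`.
    ↦-fraction : ∀ q x {r} → toℚᵘ q ℚᵘ.≃ x → ℚᵘ.↧ x ≉ 0ℤ → ℚᵘ.↥ x ≈ r * ℚᵘ.↧ x → q ↦ r
    ↦-fraction q@(mkℚ n d-1 _) x {r} (*≡* nX≡) X≉0 N≈ = reduces d≉0 (*-cancelˡ X X≉0 (begin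
      X * n            ≡⟨ ℤ.*-comm X n ⟩
      n * X            ≡⟨ nX≡ ⟩
      N * d            ≈⟨ *-monoˡ d N≈ ⟩
      r * X * d        ≡⟨ regroup r X d ⟩
      X * (r * d)      ∎))
      where
      N = ℚᵘ.↥ x
      X = ℚᵘ.↧ x
      d = ↧ q
      regroup : ∀ r X d → r * X * d ≡ X * (r * d)
      regroup = solve-∀
      d≉0 : d ≉ 0ℤ
      d≉0 d≈0 = [ (λ n≈0 → not-both q n≈0 d≈0) , X≉0 ]′ (zero-product n X (begin
        n * X    ≡⟨ nX≡ ⟩
        N * d    ≈⟨ *-monoʳ N d≈0 ⟩
        N * 0ℤ   ≡⟨ ℤ.*-zeroʳ N ⟩
        0ℤ       ∎))

    ↦-+ : ∀ {x y r s} → x ↦ r → y ↦ s → (x ℚ.+ y) ↦ (r + s)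
    ↦-+ {x@(mkℚ n d-1 _)} {y@(mkℚ n′ d-1′ _)} {r} {s} (reduces d≉0 n≈) (reduces d′≉0 n′≈) =
      ↦-fraction (x ℚ.+ y) (toℚᵘ x ℚᵘ.+ toℚᵘ y) (ℚ.toℚᵘ-homo-+ x y) (*-nonzero {↧ x} {↧ y} d≉0 d′≉0) (begin
        n * ↧ y + n′ * ↧ x                       ≈⟨ +-mono (*-monoˡ (↧ y) n≈) (*-monoˡ (↧ x) n′≈) ⟩
        r * ↧ x * ↧ y + s * ↧ y * ↧ x            ≡⟨ eq r s (↧ x) (↧ y) ⟩
        (r + s) * (↧ x * ↧ y)                    ∎)
      where
      eq : ∀ r s d d′ → r * d * d′ + s * d′ * d ≡ (r + s) * (d * d′)
      eq = solve-∀

    ↦-* : ∀ {x y r s} → x ↦ r → y ↦ s → (x ℚ.* y) ↦ (r * s)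
    ↦-* {x@(mkℚ n d-1 _)} {y@(mkℚ n′ d-1′ _)} {r} {s} (reduces d≉0 n≈) (reduces d′≉0 n′≈) =
      ↦-fraction (x ℚ.* y) (toℚᵘ x ℚᵘ.* toℚᵘ y) (ℚ.toℚᵘ-homo-* x y) (*-nonzero {↧ x} {↧ y} d≉0 d′≉0) (begin
        n * n′                                   ≈⟨ *-mono n≈ n′≈ ⟩
        (r * ↧ x) * (s * ↧ y)                    ≡⟨ eq r s (↧ x) (↧ y) ⟩
        r * s * (↧ x * ↧ y)                      ∎)
      where
      eq : ∀ r s d d′ → (r * d) * (s * d′) ≡ r * s * (d * d′)
      eq = solve-∀

    ↦-neg : ∀ {x r} → x ↦ r → (ℚ.- x) ↦ (- r)
    ↦-neg {x@(mkℚ n d-1 _)} {r} (reduces d≉0 n≈) =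
      ↦-fraction (ℚ.- x) (ℚᵘ.- toℚᵘ x) (ℚ.toℚᵘ-homo‿- x) d≉0 (begin
        - n                ≈⟨ -‿mono n≈ ⟩
        - (r * ↧ x)        ≡⟨ ℤ.neg-distribˡ-* r (↧ x) ⟩
        - r * ↧ x          ∎)

    ↦-- : ∀ {x y r s} → x ↦ r → y ↦ s → (x ℚ.- y) ↦ (r - s)
    ↦-- x↦r y↦s = ↦-+ x↦r (↦-neg y↦s)

    ↦-integer : ∀ a → ((+ a) ℚ./ 1) ↦ (+ a)
    ↦-integer a = ↦-fraction ((+ a) ℚ./ 1) (mkℚᵘ (+ a) 0) (ℚ.toℚᵘ-fromℚᵘ (mkℚᵘ (+ a) 0)) 1≉0
      (≈-reflexive (sym (ℤ.*-identityʳ (+ a))))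

    0↦0 : 0ℚ ↦ 0ℤ
    0↦0 = reduces 1≉0 ≈-refl

    1↦1 : 1ℚ ↦ 1ℤ
    1↦1 = reduces 1≉0 ≈-refl

    ↦-U : ∀ n {q r} → q ↦ r → U n q ↦ u n r
    ↦-U zero          q↦r = 0↦0
    ↦-U (suc zero)    q↦r = 1↦1
    ↦-U (suc (suc n)) q↦r = ↦-- (↦-* q↦r (↦-U (suc n) q↦r)) (↦-U n q↦r)

    ↦-C : ∀ n {q r} → q ↦ r → C n q ↦ c n r
    ↦-C zero    q↦r = ↦-+ 1↦1 1↦1
    ↦-C (suc n) q↦r = ↦-- (↦-U (suc (suc n)) q↦r) (↦-U n q↦r)

    ↦-W : ∀ i {q r} → q ↦ r → W (2 ℕ.* i ℕ.+ 1) q ↦ (u (suc i) r + u i r)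
    ↦-W i {q} q↦r rewrite half-odd i = ↦-+ (↦-U (suc i) q↦r) (↦-U i q↦r)

    ↦-V : ∀ i {q r} → q ↦ r → V (2 ℕ.* i ℕ.+ 1) q ↦ (u (suc i) r - u i r)
    ↦-V i {q} q↦r rewrite half-odd i = ↦-- (↦-U (suc i) q↦r) (↦-U i q↦r)

    ≡0⇒≈0 : ∀ {q r} → q ↦ r → q ≡0mod p → r ≈ 0ℤ
    ≡0⇒≈0 {q} {r} (reduces d≉0 n≈) p∣n =
      [ id , (λ d≈0 → contradiction d≈0 d≉0) ]′ (zero-product r (↧ q) (≈-trans (≈-sym n≈) (∣⇒≈0 p∣n)))

    ≈0⇒≡0 : ∀ {q r} → q ↦ r → r ≈ 0ℤ → q ≡0mod p
    ≈0⇒≡0 {q} {r} (reduces d≉0 n≈) r≈0 = ≈0⇒∣ (begin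
      ↥ q         ≈⟨ n≈ ⟩
      r * ↧ q     ≈⟨ *-monoˡ (↧ q) r≈0 ⟩
      0ℤ * ↧ q    ≡⟨ ℤ.*-zeroˡ (↧ q) ⟩
      0ℤ          ∎)

    inverse : ∀ {x} → x ≉ 0ℤ → ∃[ y ] x * y ≈ 1ℤ
    inverse {x} x≉0 with ℕ.m≤n⇒∃[o]m+o≡n (1<prime prime)
    -- The inverse is x^(p-2).
    ... | n , 2+n≡p = x ^ n , *-cancelˡ x {x * x ^ n} {1ℤ} x≉0 (begin
      x * (x * x ^ n)   ≡⟨ cong (x ^_) 2+n≡p ⟩
      x ^ p             ≈⟨ fermat x ⟩
      x                 ≡⟨ ℤ.*-identityʳ x ⟨
      x * 1ℤ            ∎)

    reduction : ∀ q → ↧ q ≉ 0ℤ → ∃[ r ] q ↦ r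
    reduction q d≉0 = ↥ q * proj₁ (inverse d≉0) , reduces d≉0 (begin
      ↥ q                                 ≡⟨ ℤ.*-identityʳ (↥ q) ⟨
      ↥ q * 1ℤ                            ≈⟨ *-monoʳ (↥ q) (proj₂ (inverse d≉0)) ⟨
      ↥ q * (↧ q * proj₁ (inverse d≉0))   ≡⟨ regroup (↥ q) (↧ q) (proj₁ (inverse d≉0)) ⟩
      ↥ q * proj₁ (inverse d≉0) * ↧ q     ∎)
      where
      regroup : ∀ n d e → n * (d * e) ≡ n * e * d
      regroup = solve-∀

    -- Needed because membership in `Π′` restricts only δ, while the sets `Π` ask about the
    -- denominator of q₀. If `p` divides that denominator, it does not divide the numerator `n`, and
    -- cross-multiplication forces it into the denominator of the square.
    square-denominator : ∀ q → ↧ (q ℚ.* q) ≉ 0ℤ → ↧ q ≉ 0ℤ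
    square-denominator q@(mkℚ n d-1 _) D≉0 d≈0 with ℚ.toℚᵘ-homo-* q q
    ... | *≡* N*dd≡nn*D = [ (λ nn≈0 → n≉0 (Sum.reduce (zero-product n n nn≈0))) , D≉0 ]′ (zero-product (n * n) D (begin
      n * n * D        ≡⟨ cong (n * n *_) (ℚ.↧ᵘ-toℚᵘ (q ℚ.* q)) ⟨
      n * n * D′       ≡⟨ N*dd≡nn*D ⟨
      N * (↧ q * ↧ q)  ≈⟨ *-monoʳ N (*-mono d≈0 d≈0) ⟩
      N * 0ℤ           ≡⟨ ℤ.*-zeroʳ N ⟩
      0ℤ               ∎))
      where
      n≉0 : n ≉ 0ℤ
      n≉0 n≈0 = not-both q n≈0 d≈0
      D = ↧ (q ℚ.* q)
      D′ = ℚᵘ.↧ (toℚᵘ (q ℚ.* q))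
      N = ℚᵘ.↥ (toℚᵘ (q ℚ.* q))

    legendre-spec : ∀ x → ↥ x ≉ 0ℤ → ↧ x ≉ 0ℤ →
      (legendre x p ≡ 1ℤ × IsSquare (↥ x * ↧ x)) ⊎ (legendre x p ≡ ℤ.-1ℤ × ¬ IsSquare (↥ x * ↧ x))
    -- `legendre` computes by matching on the modulus, so `p` is replaced by a variable that can be
    -- split.
    legendre-spec x n≉0 d≉0 = go p refl
      where
      N = ↥ x * ↧ x
      go : ∀ p′ → p′ ≡ p → (legendre x p′ ≡ 1ℤ × IsSquare N) ⊎ (legendre x p′ ≡ ℤ.-1ℤ × ¬ IsSquare N)
      go zero    refl = contradiction (1<prime prime) λ ()
      go (suc n) refl with N %ℕ suc n ℕ.≡ᵇ 0 in N%p≡ᵇ0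
      ... | true  = contradiction
        (≈-trans (residue N) (≈-reflexive (cong +_ (ℕ.≡ᵇ⇒≡ (N %ℕ suc n) 0 (subst T (sym N%p≡ᵇ0) tt)))))
        (*-nonzero {↥ x} {↧ x} n≉0 d≉0)
      ... | false with any (λ y → ((suc y ℕ.* suc y) ℕ.% suc n) ℕ.≡ᵇ (N %ℕ suc n)) (upTo n) in found
      ...   | true  = inj₁ (refl , square)
        where
        square : IsSquare N
        square with satisfied (any⁻ _ (upTo n) (subst T (sym found) tt))
        ... | y , yy≡ᵇN = + suc y , (begin
          + suc y * + suc y                     ≈⟨ residue (+ suc y * + suc y) ⟩
          + ((suc y ℕ.* suc y) ℕ.% suc n)       ≡⟨ cong +_ (ℕ.≡ᵇ⇒≡ ((suc y ℕ.* suc y) ℕ.% suc n) (N %ℕ suc n) yy≡ᵇN) ⟩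
          + (N %ℕ suc n)                        ≈⟨ residue N ⟨
          N                                     ∎)
      ...   | false = inj₂ (refl , λ (y , yy≈N) → not-found (y %ℕ suc n) (ℤ.n%ℕd<d y (suc n))
                        (≈-trans (≈-sym (*-mono (residue y) (residue y))) yy≈N))
        where
        not-found : ∀ y → y < suc n → + y * + y ≉ N
        -- The search runs over 1, ..., p - 1 only; the residue 0 is excluded because the argument
        -- is nonzero.
        not-found zero    _         yy≈N = *-nonzero {↥ x} {↧ x} n≉0 d≉0 (≈-sym yy≈N)
        not-found (suc y) (s≤s y<n) yy≈N = subst T found (any⁺ _ (lose (∈-upTo⁺ y<n)
          (ℕ.≡⇒≡ᵇ ((suc y ℕ.* suc y) ℕ.% suc n) (N %ℕ suc n) (≈⇒≡ (ℕ.m%n<n (suc y ℕ.* suc y) (suc n)) (ℤ.n%ℕd<d N (suc n)) (begin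
            + ((suc y ℕ.* suc y) ℕ.% suc n)       ≈⟨ residue (+ suc y * + suc y) ⟨
            + suc y * + suc y                     ≈⟨ yy≈N ⟩
            N                                     ≈⟨ residue N ⟩
            + (N %ℕ suc n)                        ∎)))))

  -- Translation to the sets of primes

  Ω⇒Π′ : ∀ q₀ σ k {p} → Ω q₀ σ k p → Π′ q₀ p
  Ω⇒Π′ q₀ σ zero    p∈Π′       = p∈Π′
  Ω⇒Π′ q₀ σ (suc k) (p∈Π′ , _) = p∈Π′

  module Translation (q₀ : ℚ) {p : ℕ} (p∈Π′ : Π′ q₀ p) where
    prime : Prime p
    prime = proj₁ (proj₁ p∈Π′)

    m : ℕ
    m = proj₁ (odd-prime (proj₁ p∈Π′))

    p≡ : p ≡ suc (m ℕ.+ m)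
    p≡ = proj₂ (odd-prime (proj₁ p∈Π′))

    open Modulo p
    open PrimeModulo prime
    open Odd m p≡
    open ChebyshevModulo p using (c-cong)
    open Reduction prime
    open import Relation.Binary.Reasoning.Setoid (CommutativeRing.setoid ℤ/)
    private instance _ = prime⇒nonZero prime

    δ-numerator≉0 : ↥ (δ q₀) ≉ 0ℤ
    δ-numerator≉0 n≈0 = proj₁ (proj₂ p∈Π′) (≈0⇒∣ n≈0)

    δ-denominator≉0 : ↧ (δ q₀) ≉ 0ℤ
    δ-denominator≉0 d≈0 = proj₂ (proj₂ p∈Π′) (≈0⇒∣ d≈0)

    4ℚ : ℚ
    4ℚ = 1ℚ ℚ.+ 1ℚ ℚ.+ 1ℚ ℚ.+ 1ℚ

    4↦4 : 4ℚ ↦ + 4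
    4↦4 = ↦-+ (↦-+ (↦-+ 1↦1 1↦1) 1↦1) 1↦1

    -- q₀² = δ + 4 reduces modulo `p` because δ does.
    q₀-denominator≉0 : ↧ q₀ ≉ 0ℤ
    q₀-denominator≉0 = square-denominator q₀ (_↦_.denominator≉0
      (subst (_↦ (proj₁ δ-reduction + + 4)) δ+4 (↦-+ (proj₂ δ-reduction) 4↦4)))
      where
      δ-reduction : ∃[ r ] δ q₀ ↦ r
      δ-reduction = reduction (δ q₀) δ-denominator≉0
      δ+4 : δ q₀ ℚ.+ 4ℚ ≡ q₀ ℚ.* q₀
      δ+4 = trans (ℚ.+-assoc (q₀ ℚ.* q₀) (ℚ.- 4ℚ) 4ℚ)
                  (trans (cong (q₀ ℚ.* q₀ ℚ.+_) (ℚ.+-inverseˡ 4ℚ)) (ℚ.+-identityʳ (q₀ ℚ.* q₀)))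

    q : ℤ
    q = proj₁ (reduction q₀ q₀-denominator≉0)

    q₀↦q : q₀ ↦ q
    q₀↦q = proj₂ (reduction q₀ q₀-denominator≉0)

    δ↦ : δ q₀ ↦ (q * q - + 4)
    δ↦ = ↦-- (↦-* q₀↦q q₀↦q) 4↦4

    δ≉0 : q * q - + 4 ≉ 0ℤ
    δ≉0 δ≈0 = proj₁ (proj₂ p∈Π′) (≈0⇒≡0 δ↦ δ≈0)

    nd≈ : ↥ (δ q₀) * ↧ (δ q₀) ≈ (q * q - + 4) * (↧ (δ q₀) * ↧ (δ q₀))
    nd≈ = ≈-trans (*-monoˡ (↧ (δ q₀)) (_↦_.numerator≈ δ↦)) (≈-reflexive (ℤ.*-assoc (q * q - + 4) (↧ (δ q₀)) (↧ (δ q₀))))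

    -- The Legendre symbol is defined by numerator times denominator, which is δ times the square of
    -- the denominator; that square has m-th power 1.
    δ^m≈ : (q * q - + 4) ^ m ≈ (↥ (δ q₀) * ↧ (δ q₀)) ^ m
    δ^m≈ = begin
      (q * q - + 4) ^ m                      ≡⟨ ℤ.*-identityʳ ((q * q - + 4) ^ m) ⟨
      (q * q - + 4) ^ m * 1ℤ                 ≈⟨ *-monoʳ ((q * q - + 4) ^ m) (euler-square {d * d} {d} (*-nonzero {d} {d} δ-denominator≉0 δ-denominator≉0) ≈-refl) ⟨
      (q * q - + 4) ^ m * (d * d) ^ m        ≈⟨ ^-distrib-* (q * q - + 4) (d * d) m ⟨
      ((q * q - + 4) * (d * d)) ^ m          ≈⟨ ^-congˡ m nd≈ ⟨
      (↥ (δ q₀) * d) ^ m                     ∎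
      where
      d = ↧ (δ q₀)

    hat-split : legendre (δ q₀) p ≡ 1ℤ → hat q₀ p ≡ m
    hat-split leg≡1 = trans (cong₂ (λ x l → ℤ.∣ + x - l ∣ ℕ./ 2) p≡ leg≡1) (half-double m)

    hat-inert : legendre (δ q₀) p ≡ ℤ.-1ℤ → hat q₀ p ≡ suc m
    hat-inert leg≡-1 = trans (cong₂ (λ x l → ℤ.∣ + x - l ∣ ℕ./ 2) p≡ leg≡-1)
      (trans (cong (ℕ._/ 2) (eq m)) (half-double (suc m)))
      where
      eq : ∀ m → suc (m ℕ.+ m) ℕ.+ 1 ≡ suc m ℕ.+ suc m
      eq = ℕ-Solver.solve-∀

    hat-cases : HasHat p m (q * q - + 4) (hat q₀ p)
    hat-cases = Sum.map
      (λ (leg≡1 , (y , yy≈nd)) → ≈-trans δ^m≈ (euler-square {↥ (δ q₀) * ↧ (δ q₀)} {y} nd≉0 yy≈nd) , hat-split leg≡1)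
      (λ (leg≡-1 , nonsquare) → ≈-trans δ^m≈ (euler-nonsquare nd≉0 nonsquare) , hat-inert leg≡-1)
      (legendre-spec (δ q₀) δ-numerator≉0 δ-denominator≉0)
      where
      nd≉0 : ↥ (δ q₀) * ↧ (δ q₀) ≉ 0ℤ
      nd≉0 = *-nonzero {↥ (δ q₀)} {↧ (δ q₀)} δ-numerator≉0 δ-denominator≉0

    open Descent prime p≡ q δ≉0 hat-cases public

    target : Sign q₀ → ℤ
    target plus  = q
    target minus = - q

    ↦-± : ∀ σ {x r} → x ↦ r → _±_ q₀ x σ ↦ (r - target σ)
    ↦-± plus  x↦r = ↦-- x↦r q₀↦q
    ↦-± minus {x} {r} x↦r = subst (λ s → (x ℚ.+ q₀) ↦ (r + s)) (sym (ℤ.neg-involutive q)) (↦-+ x↦r q₀↦q)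

    Ω⇒Root : ∀ σ k → Ω q₀ σ k p → Root k (target σ)
    -- C_1 is the identity, so level 0 imposes no condition, in accordance with Ω_0 being all of
    -- `Π′`.
    Ω⇒Root σ zero    _                 = target σ , ≈-reflexive (c₁ (target σ))
    Ω⇒Root σ (suc k) (_ , a , _ , root) =
      + a , -≈0⇒≈ (≡0⇒≈0 (↦-± σ (↦-C (2 ℕ.^ suc k) (↦-integer a))) root)

    Root⇒Ω : ∀ σ k → Root k (target σ) → Ω q₀ σ k p
    Root⇒Ω σ zero    _          = p∈Π′
    Root⇒Ω σ (suc k) (a , root) = p∈Π′ , a %ℕ p , ℤ.n%ℕd<d a p ,
      ≈0⇒≡0 (↦-± σ (↦-C (2 ℕ.^ suc k) (↦-integer (a %ℕ p))))
        (≈⇒-≈0 (≈-trans (c-cong (2 ℕ.^ suc k) (≈-sym (residue a))) root))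

    R⇒Both : ∀ k → R q₀ k p → Both k
    R⇒Both k (Ω₊ , Ω₋) = Ω⇒Root plus k Ω₊ , Ω⇒Root minus k Ω₋

    odd : OddPrime p
    odd = proj₁ p∈Π′

    p∤q₀ : ¬ (p ∣ ↧ₙ q₀)
    p∤q₀ p∣d = q₀-denominator≉0 (∣⇒≈0 p∣d)

    exactly : ∀ k i → hat q₀ p ≡ suc (i ℕ.+ i) ℕ.* 2 ℕ.^ k → (2 ℕ.^ k) ∥ hat q₀ p
    exactly k i hat≡ = divides (suc (i ℕ.+ i)) hat≡ , odd-multiple⇒∤ {k = k} i hat≡

    Ω⁺∖Ω⁻⊆ : ∀ k → Ω q₀ plus (suc k) p × ¬ Ω q₀ minus (suc k) p × R q₀ k p → Π q₀ 0 p × (2 ℕ.^ k) ∥ hat q₀ p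
    Ω⁺∖Ω⁻⊆ k (Ω₊ , ¬Ω₋ , Rₖ) =
      let i , hat≡ , cᵢ≈2 = one-sided pos k (Ω⇒Root plus (suc k) Ω₊) (¬Ω₋ ∘ Root⇒Ω minus (suc k)) (R⇒Both k Rₖ)
      in (odd , p∤q₀ , i , ≈0⇒≡0 (↦-W i q₀↦q) (c≈2⇒w≈0 i cᵢ≈2)) , exactly k i hat≡

    Ω⁻∖Ω⁺⊆ : ∀ k → Ω q₀ minus (suc k) p × ¬ Ω q₀ plus (suc k) p × R q₀ k p → Π q₀ 1 p × (2 ℕ.^ k) ∥ hat q₀ p
    Ω⁻∖Ω⁺⊆ k (Ω₋ , ¬Ω₊ , Rₖ) =
      let i , hat≡ , cᵢ≈2 = one-sided neg k (Ω⇒Root minus (suc k) Ω₋)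
                              (¬Ω₊ ∘ Root⇒Ω plus (suc k) ∘ subst (Root (suc k)) (ℤ.neg-involutive q)) (R⇒Both k Rₖ)
          -- At an odd index the value 2 at `- q` becomes -2 at `q`, which is why V takes the place
          -- of W.
          cᵢ≈-2 = subst (λ x → c (suc (i ℕ.+ i)) x ≈ - + 2) (ℤ.neg-involutive q) (c-odd-neg i (- q) (+ 2) cᵢ≈2)
      in (odd , p∤q₀ , i , ≈0⇒≡0 (↦-V i q₀↦q) (c≈-2⇒v≈0 i cᵢ≈-2)) , exactly k i hat≡

    Z⊆ : ∀ k → Z q₀ (suc k) p → Π* q₀ p × 2 ℕ.^ suc k ∣ hat q₀ p
    Z⊆ k (Rₖ , ¬Ω₊ , ¬Ω₋) =
      let i , hat≡ , cᵢ≈0 = neither k (R⇒Both k Rₖ) (¬Ω₊ ∘ Root⇒Ω plus (suc k)) (¬Ω₋ ∘ Root⇒Ω minus (suc k))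
          -- The index is nonzero because C_0 = 2 does not vanish modulo an odd prime.
          j , l , i≡ = 2-adic i (λ i≡0 → 2≉0 (subst (λ i → c i q ≈ 0ℤ) i≡0 cᵢ≈0))
      in (suc (suc j) , s≤s (s≤s z≤n) , odd , p∤q₀ , l ,
          ≈0⇒≡0 (↦-C (2 ℕ.^ j ℕ.* (2 ℕ.* l ℕ.+ 1)) q₀↦q) (subst (λ i → c i q ≈ 0ℤ) i≡ cᵢ≈0))
         , divides i hat≡

    R⊆ : ∀ k → R q₀ (suc k) p → 2 ℕ.^ suc k ∣ hat q₀ p
    R⊆ k Rₖ = Both⇒∣ (suc k) (R⇒Both (suc k) Rₖ)

open ChebyshevCongruences
open import Data.Nat using (_^_)
open import Data.Rational using (_+_; _-_)

theorem13 : (q₀ : ℚ) → ¬ IsRationalSquare ((1ℚ + 1ℚ) + q₀) → ¬ IsRationalSquare ((1ℚ + 1ℚ) - q₀) →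
    (k : ℕ) → 1 ≤ k → (p : ℕ) →
    ((Ω q₀ plus k p × ¬ Ω q₀ minus k p × R q₀ (k ∸ 1) p) → Π q₀ 0 p × (2 ^ (k ∸ 1)) ∥ hat q₀ p)
    × ((Ω q₀ minus k p × ¬ Ω q₀ plus k p × R q₀ (k ∸ 1) p) → Π q₀ 1 p × (2 ^ (k ∸ 1)) ∥ hat q₀ p)
    × (Z q₀ k p → Π* q₀ p × 2 ^ k ∣ hat q₀ p)
    × (R q₀ k p → 2 ^ k ∣ hat q₀ p)
theorem13 q₀ _ _ (suc k) _ p =
  (λ h@(Ω₊ , _) → Translation.Ω⁺∖Ω⁻⊆ q₀ (Ω⇒Π′ q₀ plus (suc k) Ω₊) k h) ,
  (λ h@(Ω₋ , _) → Translation.Ω⁻∖Ω⁺⊆ q₀ (Ω⇒Π′ q₀ minus (suc k) Ω₋) k h) ,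
  (λ h@((Ω₊ , _) , _) → Translation.Z⊆ q₀ (Ω⇒Π′ q₀ plus k Ω₊) k h) ,
  (λ h@(Ω₊ , _) → Translation.R⊆ q₀ (Ω⇒Π′ q₀ plus (suc k) Ω₊) k h)
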